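{- For every integer $k\ge 2$, $F_{k\cdots 21}(x,y)=F_{12\cdots k}(x,y)$, and $F=F_{12\cdots k}(x,y)$ satisfies $$F=\sum_{n=0}^{k-2}x^nF^n+\frac{x^{k-1}F^{k-1}}{1-xyF}.$$
   Context: The patterns $12\cdots k$ and $k\cdots 21$ are written without dashes, so an occurrence of $12\cdots k$ (resp. $k\cdots21$) in $\pi=\pi_1\cdots\pi_n\in S_n$ is a position $i$ with $\pi_i<\pi_{i+1}<\dots<\pi_{i+k-1}$ (resp. $\pi_i>\pi_{i+1}>\dots>\pi_{i+k-1}$). A permutation is $1\text{ - }3\text{ - }2$-avoiding if there are no positions $a<b<c$ with $\pi_a<\pi_c<\pi_b$. For a pattern $\tau$, $f_{\tau;r}(n)$ is the number of $1\text{ - }3\text{ - }2$-avoiding permutations in $S_n$ containing exactly $r$ occurrences of $\tau$ (with $S_0$ consisting of the empty permutation), and $F_\tau(x,y)=\sum_{n,r\ge 0} f_{\tau;r}(n)x^ny^r$, viewed as a formal power series in $x$ with coefficients in $\mathbb Z[y]$. -}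

module Defs where

open import Algebra.Bundles using (RawRing)
import Algebra.Definitions.RawMonoid as RawMonoidDefs
import Algebra.Definitions.RawSemiring as RawSemiringDefs
open import Data.Fin as Fin using (Fin; zero; suc; toℕ)
import Data.Fin.Properties as Fin
open import Data.Integer as ℤ using (ℤ; +_; 0ℤ; 1ℤ)
import Data.Integer.Properties as ℤ
open import Data.List as List using (List; []; _∷_; length; filter; take; drop; allFin)
import Data.List.Properties as List
open import Data.List.Relation.Unary.All using (universal)
open import Data.List.Relation.Unary.Linked using (Linked; linked?)
open import Data.Nat as ℕ using (ℕ; zero; suc; _∸_; _≤_; s≤s; z≤n)
import Data.Nat.Properties as ℕ
open import Data.Product using (_×_; _,_; proj₂)
open import Data.Sum using (_⊎_; inj₁; inj₂)
open import Data.Vec as Vec using (Vec; []; _∷_; lookup; toList)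
open import Data.Vec.Functional using (Vector)
open import Data.Vec.Relation.Unary.AllPairs using (allPairs?)
open import Data.Vec.Relation.Unary.Unique.Propositional using (Unique)
open import Function using (_∘_)
open import Level using (0ℓ)
open import Relation.Binary.PropositionalEquality
open import Relation.Nullary using (¬_)
open import Relation.Nullary.Decidable using (_×-dec_; _→-dec_; ¬?)
open import Relation.Unary using (Decidable)

module PowerSeries {c ℓ} (R : RawRing c ℓ) where

  open RawRing R
  open RawMonoidDefs +-rawMonoid using (sum)

  Series : Set c
  Series = ℕ → Carrier

  constant : Carrier → Series
  constant a zero    = a
  constant a (suc _) = 0#

  indeterminate : Series
  indeterminate (suc zero) = 1#
  indeterminate _          = 0#

  _⊛_ : Series → Series → Series
  (f ⊛ g) n = sum {suc n} λ i → f (toℕ i) * g (n ∸ toℕ i)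

  rawRing : RawRing c ℓ
  rawRing = record
    { Carrier = Series
    ; _≈_     = λ f g → ∀ n → f n ≈ g n
    ; _+_     = λ f g n → f n + g n
    ; _*_     = _⊛_
    ; -_      = λ f n → - f n
    ; 0#      = constant 0#
    ; 1#      = constant 1#
    }

-- ℤ[y], as the power series over ℤ with finitely many nonzero
-- coefficients. The bound is only a witness of finiteness: it need not be
-- sharp, and equality of polynomials ignores it.

open PowerSeries ℤ.+-*-rawRing using ()
  renaming (Series to ℤSeries; rawRing to ℤ⟦y⟧;
            constant to ℤconstant; indeterminate to ℤindeterminate)

private
  module S = RawRing ℤ⟦y⟧
  open RawMonoidDefs ℤ.+-0-rawMonoid using (sum)

record Polynomial : Set where
  constructor polynomial
  field
    coeff  : ℤSeries
    bound  : ℕ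
    vanish : ∀ r → bound ≤ r → coeff r ≡ 0ℤ

open Polynomial public

private
  sum-zero : ∀ {n} (v : Vector ℤ n) → (∀ i → v i ≡ 0ℤ) → sum v ≡ 0ℤ
  sum-zero {zero}  v v≡0 = refl
  sum-zero {suc n} v v≡0 =
    cong₂ ℤ._+_ (v≡0 zero) (sum-zero (v ∘ suc) (v≡0 ∘ suc))

  constant-vanish : ∀ a r → 1 ≤ r → ℤconstant a r ≡ 0ℤ
  constant-vanish a (suc r) _ = refl

  indeterminate-vanish : ∀ r → 2 ≤ r → ℤindeterminate r ≡ 0ℤ
  indeterminate-vanish (suc (suc r)) _         = refl
  indeterminate-vanish (suc zero)    (s≤s ())

  +-vanish : ∀ p q r → bound p ℕ.⊔ bound q ≤ r → (coeff p S.+ coeff q) r ≡ 0ℤ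
  +-vanish p q r b≤r =
    cong₂ ℤ._+_ (vanish p r (ℕ.m⊔n≤o⇒m≤o (bound p) (bound q) b≤r))
                (vanish q r (ℕ.m⊔n≤o⇒n≤o (bound p) (bound q) b≤r))

  split : ∀ a b n i → a ℕ.+ b ≤ n → a ≤ i ⊎ b ≤ n ∸ i
  split a b n i a+b≤n with ℕ.≤-total a i
  ... | inj₁ a≤i = inj₁ a≤i
  ... | inj₂ i≤a = inj₂ (ℕ.m+n≤o⇒m≤o∸n b
          (ℕ.≤-trans (ℕ.+-monoʳ-≤ b i≤a) (subst (_≤ n) (ℕ.+-comm a b) a+b≤n)))

  *-vanish : ∀ p q r → bound p ℕ.+ bound q ≤ r → (coeff p S.* coeff q) r ≡ 0ℤ
  *-vanish p q r b≤r = sum-zero _ term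
    where
    term : ∀ (i : Fin (suc r)) → coeff p (toℕ i) ℤ.* coeff q (r ∸ toℕ i) ≡ 0ℤ
    term i with split (bound p) (bound q) r (toℕ i) b≤r
    ... | inj₁ b≤i = trans (cong (ℤ._* coeff q (r ∸ toℕ i)) (vanish p _ b≤i))
                           (ℤ.*-zeroˡ (coeff q (r ∸ toℕ i)))
    ... | inj₂ b≤j = trans (cong (coeff p (toℕ i) ℤ.*_) (vanish q _ b≤j))
                           (ℤ.*-zeroʳ (coeff p (toℕ i)))

ℤ[y] : RawRing 0ℓ 0ℓ
ℤ[y] = record
  { Carrier = Polynomial
  ; _≈_     = λ p q → coeff p S.≈ coeff q
  ; _+_     = λ p q → polynomial (coeff p S.+ coeff q) _ (+-vanish p q)
  ; _*_     = λ p q → polynomial (coeff p S.* coeff q) _ (*-vanish p q)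
  ; -_      = λ p → polynomial (S.- coeff p) (bound p)
                      (λ r b≤r → cong ℤ.-_ (vanish p r b≤r))
  ; 0#      = polynomial S.0# 1 (constant-vanish 0ℤ)
  ; 1#      = polynomial S.1# 1 (constant-vanish 1ℤ)
  }

open PowerSeries ℤ[y] public using ()
  renaming (rawRing to ℤ[y]⟦x⟧; indeterminate to x)

open RawRing ℤ[y]⟦x⟧ public
  using (_≈_; _+_; _*_; -_; 0#; 1#)
open RawSemiringDefs (RawRing.rawSemiring ℤ[y]⟦x⟧) public
  using (_^_; sum)

y : RawRing.Carrier ℤ[y]⟦x⟧
y = PowerSeries.constant ℤ[y]
      (polynomial ℤindeterminate 2 indeterminate-vanish)

-- One-line notation; letters and positions start at 0.
Word : ℕ → Set
Word n = Vec (Fin n) n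

vectors : ∀ n m → List (Vec (Fin n) m)
vectors n zero    = [] ∷ []
vectors n (suc m) = List.cartesianProductWith _∷_ (allFin n) (vectors n m)

unique? : ∀ {n} → Decidable {A = Word n} Unique
unique? = allPairs? (λ i j → ¬? (i Fin.≟ j))

-- A word of length n over n letters is a permutation iff no letter repeats.
permutations : ∀ n → List (Word n)
permutations n = filter unique? (vectors n n)

Avoids132 : ∀ {n} → Word n → Set
Avoids132 {n} π = ∀ (a b c : Fin n) → a Fin.< b → b Fin.< c →
  ¬ (lookup π a Fin.< lookup π c × lookup π c Fin.< lookup π b)

avoids132? : ∀ {n} → Decidable (Avoids132 {n})
avoids132? π = Fin.all? λ a → Fin.all? λ b → Fin.all? λ c →
  (a Fin.<? b) →-dec (b Fin.<? c) →-dec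
  ¬? ((lookup π a Fin.<? lookup π c) ×-dec (lookup π c Fin.<? lookup π b))

-- The argument k is the length of the pattern 12⋯k or k⋯21.
data Pattern : Set where
  12⋯_ : ℕ → Pattern
  _⋯21 : ℕ → Pattern

-- The window π_i … π_{i+k-1} lies inside π and is strictly monotone; since an
-- occurrence of a nonempty pattern starts at a letter, i : Fin n loses nothing.
OccursAt : ∀ {n} → Pattern → Word n → Fin n → Set
OccursAt {n} (12⋯ k) π i =
  toℕ i ℕ.+ k ≤ n × Linked Fin._<_ (take k (drop (toℕ i) (toList π)))
OccursAt {n} (k ⋯21) π i =
  toℕ i ℕ.+ k ≤ n × Linked Fin._>_ (take k (drop (toℕ i) (toList π)))

occursAt? : ∀ {n} τ (π : Word n) → Decidable (OccursAt τ π)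
occursAt? (12⋯ k) π i = (_ ℕ.≤? _) ×-dec linked? Fin._<?_ _
occursAt? (k ⋯21) π i = (_ ℕ.≤? _) ×-dec linked? (λ a b → b Fin.<? a) _

occurrences : ∀ {n} → Pattern → Word n → ℕ
occurrences {n} τ π = length (filter (occursAt? τ π) (allFin n))

f : Pattern → ℕ → ℕ → ℕ
f τ r n = length (filter (λ π → avoids132? π ×-dec (occurrences τ π ℕ.≟ r))
                         (permutations n))

private
  occurrences≤n : ∀ {n} τ (π : Word n) → occurrences τ π ≤ n
  occurrences≤n {n} τ π =
    subst (occurrences τ π ≤_) (List.length-tabulate (λ (i : Fin n) → i))
      (List.length-filter (occursAt? τ π) (allFin n))

  f-vanish : ∀ τ n r → suc n ≤ r → + f τ r n ≡ 0ℤ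
  f-vanish τ n r n<r = cong (+_ ∘ length)
    (List.filter-none _ (universal
      (λ π good → ℕ.<⇒≱ n<r (subst (_≤ n) (proj₂ good) (occurrences≤n τ π)))
      (permutations n)))

-- F τ is F_τ(x,y): the coefficient of xⁿ is the polynomial Σᵣ f_{τ;r}(n) yʳ.
F : Pattern → RawRing.Carrier ℤ[y]⟦x⟧
F τ n = polynomial (λ r → + f τ r n) (suc n) (f-vanish τ n)

-- A 1-3-2-avoiding permutation is empty or of the form A n B, with A and B
-- 1-3-2-avoiding and every letter of A above every letter of B; so it is a binary
-- tree. The letter n ends an occurrence of 12⋯k iff the final increasing run of A
-- has length at least k - 1. Dually n starts an occurrence of k⋯21 iff the initial
-- decreasing run of B has length at least k - 1, which is the same condition on the
-- mirror image of the tree; hence the two series agree.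
--
-- Let S be the series of all A n, the occurrence ended by n included, and E j the
-- series of the permutations whose final run has length j, so F = 1 + S F. The
-- final run of A n B is that of B, or that of A n if B is empty, whence
-- E (j+1) = x yᵉ E j + S E (j+1) with e = 1 if j + 1 ≥ k and e = 0 otherwise.
-- Since F (1 - S) = 1, this is E (j+1) = x yᵉ F E j. The final runs of length at
-- least k - 1 are collected in one series H, with H = x F (E (k-2) + y H).

module Submission where

open import Defs using (module PowerSeries; Pattern; 12⋯_; _⋯21; Word; vectors; unique?;
  permutations; Avoids132; avoids132?; occursAt?; occurrences)
open import Algebra.Bundles using (CommutativeRing; CommutativeMonoid; RawRing)
import Algebra.Definitions as AlgebraDefs
import Algebra.Definitions.RawSemiring as RawSemiringDefs
open import Algebra.Morphism.Structures using (module RingMorphisms)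
import Algebra.Morphism.RingMonomorphism as RingMonomorphism
import Algebra.Properties.AbelianGroup as AbelianGroupProperties
import Algebra.Properties.CommutativeSemigroup as CommutativeSemigroupProperties
import Algebra.Properties.CommutativeSemiring.Exp as ExpProperties
import Algebra.Properties.Ring as RingProperties
import Algebra.Properties.Semiring.Sum as SumProperties
open import Algebra.Structures using (IsCommutativeRing)
open import Data.Bool using (Bool; true; false; if_then_else_)
open import Data.Bool.Properties using (if-float)
open import Data.Fin as Fin using (Fin; zero; suc; toℕ)
import Data.Fin.Properties as Fin
open import Data.Integer as ℤ using (0ℤ; 1ℤ)
import Data.Integer.Properties as ℤ
open import Data.List as List using (List; []; _∷_; _++_; length; filter; concat;
  tabulate; allFin; applyUpTo; cartesianProductWith)
import Data.List.Properties as List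
open import Data.Nat as ℕ using (ℕ; zero; suc; _≤_; _<_; _∸_; z≤n; s≤s; _<ᵇ_; _≡ᵇ_)
import Data.Nat.Properties as ℕ
open import Data.List.Membership.Propositional using (_∈_; _∉_)
open import Data.List.Membership.DecPropositional ℕ._≟_ using (_∈?_)
open import Data.List.Membership.Propositional.Properties
open import Data.List.Relation.Unary.All as All using (All; []; _∷_)
import Data.List.Relation.Unary.All.Properties as All
open import Data.List.Relation.Unary.AllPairs as AllPairs using (AllPairs; []; _∷_)
import Data.List.Relation.Unary.AllPairs.Properties as AllPairs
open import Data.List.Relation.Unary.Any using (here; there)
open import Data.List.Relation.Unary.Linked using (Linked; [-]; _∷_)
open import Data.List.Relation.Unary.Unique.Propositional using (Unique)
import Data.List.Relation.Unary.Unique.Propositional.Properties as Unique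
open import Data.Product as Product using (_×_; _,_; proj₁; proj₂; ∃; Σ-syntax)
open import Data.Sum using (inj₁; inj₂)
open import Data.Unit using (⊤; tt)
open import Data.Vec as Vec using (Vec; []; _∷_; lookup; toList)
import Data.Vec.Properties as Vec
import Data.Vec.Relation.Unary.All.Properties as VecAll
import Data.Vec.Relation.Unary.AllPairs as VecAllPairs
import Data.Vec.Relation.Unary.Unique.Propositional as VecUnique
open import Function using (_∘_; _on_; id)
open import Function.Bundles using (_⇔_; mk⇔; module Equivalence)
open import Level using (0ℓ)
open import Relation.Binary using (Rel; Decidable)
open import Relation.Binary.PropositionalEquality as ≡ using (_≡_; _≢_)
import Relation.Binary.Reasoning.Setoid as SetoidReasoning
open import Relation.Nullary using (¬_; yes; no; does; contradiction)
open import Relation.Nullary.Decidable using (_×-dec_; dec-true; dec-false)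
open import Relation.Nullary.Reflects using (ofʸ; ofⁿ)
import Relation.Unary as U

-- Formal power series over a commutative ring.

module PowerSeriesProperties {c ℓ} (R : CommutativeRing c ℓ) where

  open CommutativeRing R hiding (zero)
  open PowerSeries rawRing using (Series; constant; indeterminate)
    renaming (_⊛_ to infixl 7 _⊛_)
  open SetoidReasoning setoid
  open CommutativeSemigroupProperties
    (CommutativeMonoid.commutativeSemigroup +-commutativeMonoid)
    using (interchange)

  infix 4 _≐_
  _≐_ : Series → Series → Set ℓ
  f ≐ g = ∀ n → f n ≈ g n

  infixl 6 _⊕_
  _⊕_ : Series → Series → Series
  (f ⊕ g) n = f n + g n

  -- A coefficient of a product depends only on the coefficients of the factors up to the same
  -- degree; the stability of geometric partial sums rests on this truncated form.
  ⊛-cong≤ : ∀ f f′ g g′ n → (∀ i → i ≤ n → f i ≈ f′ i) →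
            (∀ i → i ≤ n → g i ≈ g′ i) → (f ⊛ g) n ≈ (f′ ⊛ g′) n
  ⊛-cong≤ f f′ g g′ zero    f≈ g≈ = +-congʳ (*-cong (f≈ 0 z≤n) (g≈ 0 z≤n))
  ⊛-cong≤ f f′ g g′ (suc n) f≈ g≈ =
    +-cong (*-cong (f≈ 0 z≤n) (g≈ (suc n) ℕ.≤-refl))
           (⊛-cong≤ (f ∘ suc) (f′ ∘ suc) g g′ n (λ i i≤n → f≈ (suc i) (s≤s i≤n))
                      (λ i i≤n → g≈ i (ℕ.m≤n⇒m≤1+n i≤n)))

  ⊛-cong : ∀ f f′ g g′ → f ≐ f′ → g ≐ g′ → f ⊛ g ≐ f′ ⊛ g′
  ⊛-cong f f′ g g′ f≈ g≈ n = ⊛-cong≤ f f′ g g′ n (λ i _ → f≈ i) (λ i _ → g≈ i)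

  ⊛-zeroˡ : ∀ f g → (∀ n → f n ≈ 0#) → ∀ n → (f ⊛ g) n ≈ 0#
  ⊛-zeroˡ f g f≈0 zero = begin
    f 0 * g 0 + 0# ≈⟨ +-identityʳ _ ⟩
    f 0 * g 0      ≈⟨ *-congʳ (f≈0 0) ⟩
    0# * g 0       ≈⟨ zeroˡ _ ⟩
    0#             ∎
  ⊛-zeroˡ f g f≈0 (suc n) = begin
    f 0 * g (suc n) + (f ∘ suc ⊛ g) n
      ≈⟨ +-cong (*-congʳ (f≈0 0)) (⊛-zeroˡ (f ∘ suc) g (f≈0 ∘ suc) n) ⟩
    0# * g (suc n) + 0#               ≈⟨ +-identityʳ _ ⟩
    0# * g (suc n)                    ≈⟨ zeroˡ _ ⟩
    0#                                ∎

  constant-⊛ : ∀ a f n → (constant a ⊛ f) n ≈ a * f n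
  constant-⊛ a f zero    = +-identityʳ _
  constant-⊛ a f (suc n) = begin
    a * f (suc n) + (constant a ∘ suc ⊛ f) n ≈⟨ +-congˡ (⊛-zeroˡ _ f (λ _ → refl) n) ⟩
    a * f (suc n) + 0#                       ≈⟨ +-identityʳ _ ⟩
    a * f (suc n)                            ∎

  indeterminate-⊛ : ∀ f n → (indeterminate ⊛ f) (suc n) ≈ f n
  indeterminate-⊛ f n = begin
    0# * f (suc n) + (indeterminate ∘ suc ⊛ f) n
      ≈⟨ +-cong (zeroˡ _) (⊛-cong (indeterminate ∘ suc) (constant 1#) f f
           (λ { zero → refl ; (suc _) → refl }) (λ _ → refl) n) ⟩
    0# + (constant 1# ⊛ f) n ≈⟨ +-identityˡ _ ⟩
    (constant 1# ⊛ f) n      ≈⟨ constant-⊛ 1# f n ⟩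
    1# * f n                 ≈⟨ *-identityˡ _ ⟩
    f n                      ∎

  indeterminate-⊛-zero : ∀ f → (indeterminate ⊛ f) 0 ≈ 0#
  indeterminate-⊛-zero f = trans (+-identityʳ _) (zeroˡ _)

  -- The defining sum splits off the head of the left factor. Splitting off the head of the right
  -- factor as well makes commutativity an induction.
  ⊛-sucʳ : ∀ f g n → (f ⊛ g) (suc n) ≈ f (suc n) * g 0 + (f ⊛ g ∘ suc) n
  ⊛-sucʳ f g zero = begin
    f 0 * g 1 + (f 1 * g 0 + 0#) ≈⟨ +-congˡ (+-identityʳ _) ⟩
    f 0 * g 1 + f 1 * g 0        ≈⟨ +-comm _ _ ⟩
    f 1 * g 0 + f 0 * g 1        ≈⟨ +-congˡ (+-identityʳ _) ⟨
    f 1 * g 0 + (f 0 * g 1 + 0#) ∎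
  ⊛-sucʳ f g (suc n) = begin
    f 0 * g (2 ℕ.+ n) + (f ∘ suc ⊛ g) (suc n)
      ≈⟨ +-congˡ (⊛-sucʳ (f ∘ suc) g n) ⟩
    f 0 * g (2 ℕ.+ n) + (f (2 ℕ.+ n) * g 0 + (f ∘ suc ⊛ g ∘ suc) n)
      ≈⟨ +-assoc _ _ _ ⟨
    f 0 * g (2 ℕ.+ n) + f (2 ℕ.+ n) * g 0 + (f ∘ suc ⊛ g ∘ suc) n
      ≈⟨ +-congʳ (+-comm _ _) ⟩
    f (2 ℕ.+ n) * g 0 + f 0 * g (2 ℕ.+ n) + (f ∘ suc ⊛ g ∘ suc) n
      ≈⟨ +-assoc _ _ _ ⟩
    f (2 ℕ.+ n) * g 0 + (f ⊛ g ∘ suc) (suc n) ∎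

  ⊛-comm : ∀ f g n → (f ⊛ g) n ≈ (g ⊛ f) n
  ⊛-comm f g zero    = +-congʳ (*-comm _ _)
  ⊛-comm f g (suc n) = begin
    f 0 * g (suc n) + (f ∘ suc ⊛ g) n ≈⟨ +-cong (*-comm _ _) (⊛-comm (f ∘ suc) g n) ⟩
    g (suc n) * f 0 + (g ⊛ f ∘ suc) n ≈⟨ ⊛-sucʳ g f n ⟨
    (g ⊛ f) (suc n)                   ∎

  ⊛-distribʳ : ∀ h f g n → ((f ⊕ g) ⊛ h) n ≈ (f ⊛ h) n + (g ⊛ h) n
  ⊛-distribʳ h f g zero = begin
    (f 0 + g 0) * h 0 + 0#                ≈⟨ +-cong (distribʳ _ _ _) (sym (+-identityˡ _)) ⟩
    f 0 * h 0 + g 0 * h 0 + (0# + 0#)     ≈⟨ interchange _ _ _ _ ⟩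
    f 0 * h 0 + 0# + (g 0 * h 0 + 0#)     ∎
  ⊛-distribʳ h f g (suc n) = begin
    (f 0 + g 0) * h (suc n) + ((f ⊕ g) ∘ suc ⊛ h) n
      ≈⟨ +-cong (distribʳ _ _ _) (⊛-distribʳ h (f ∘ suc) (g ∘ suc) n) ⟩
    f 0 * h (suc n) + g 0 * h (suc n) + ((f ∘ suc ⊛ h) n + (g ∘ suc ⊛ h) n)
      ≈⟨ interchange _ _ _ _ ⟩
    (f ⊛ h) (suc n) + (g ⊛ h) (suc n) ∎

  *-⊛-assoc : ∀ a f g n → ((λ i → a * f i) ⊛ g) n ≈ a * (f ⊛ g) n
  *-⊛-assoc a f g zero = begin
    a * f 0 * g 0 + 0#     ≈⟨ +-cong (*-assoc _ _ _) (sym (zeroʳ a)) ⟩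
    a * (f 0 * g 0) + a * 0# ≈⟨ distribˡ _ _ _ ⟨
    a * (f 0 * g 0 + 0#)   ∎
  *-⊛-assoc a f g (suc n) = begin
    a * f 0 * g (suc n) + ((λ i → a * f (suc i)) ⊛ g) n
      ≈⟨ +-cong (*-assoc _ _ _) (*-⊛-assoc a (f ∘ suc) g n) ⟩
    a * (f 0 * g (suc n)) + a * (f ∘ suc ⊛ g) n ≈⟨ distribˡ _ _ _ ⟨
    a * (f ⊛ g) (suc n)                         ∎

  ⊛-assoc : ∀ f g h n → (f ⊛ g ⊛ h) n ≈ (f ⊛ (g ⊛ h)) n
  ⊛-assoc f g h zero = begin
    (f 0 * g 0 + 0#) * h 0 + 0#  ≈⟨ +-congʳ (*-congʳ (+-identityʳ _)) ⟩
    f 0 * g 0 * h 0 + 0#         ≈⟨ +-congʳ (*-assoc _ _ _) ⟩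
    f 0 * (g 0 * h 0) + 0#       ≈⟨ +-congʳ (*-congˡ (+-identityʳ _)) ⟨
    f 0 * (g 0 * h 0 + 0#) + 0#  ∎
  ⊛-assoc f g h (suc n) = begin
    (f 0 * g 0 + 0#) * h (suc n) + (((λ i → f 0 * g (suc i)) ⊕ f ∘ suc ⊛ g) ⊛ h) n
      ≈⟨ +-cong (trans (*-congʳ (+-identityʳ _)) (*-assoc _ _ _))
                (⊛-distribʳ h (λ i → f 0 * g (suc i)) (f ∘ suc ⊛ g) n) ⟩
    f 0 * (g 0 * h (suc n)) + (((λ i → f 0 * g (suc i)) ⊛ h) n + (f ∘ suc ⊛ g ⊛ h) n)
      ≈⟨ +-congˡ (+-cong (*-⊛-assoc (f 0) (g ∘ suc) h n) (⊛-assoc (f ∘ suc) g h n)) ⟩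
    f 0 * (g 0 * h (suc n)) + (f 0 * (g ∘ suc ⊛ h) n + (f ∘ suc ⊛ (g ⊛ h)) n)
      ≈⟨ +-assoc _ _ _ ⟨
    f 0 * (g 0 * h (suc n)) + f 0 * (g ∘ suc ⊛ h) n + (f ∘ suc ⊛ (g ⊛ h)) n
      ≈⟨ +-congʳ (distribˡ _ _ _) ⟨
    (f ⊛ (g ⊛ h)) (suc n) ∎

  constant-0 : ∀ n → constant 0# n ≈ 0#
  constant-0 zero    = refl
  constant-0 (suc _) = refl

  ⊛-identityˡ : ∀ f → constant 1# ⊛ f ≐ f
  ⊛-identityˡ f n = trans (constant-⊛ 1# f n) (*-identityˡ _)

  ⊛-identityʳ : ∀ f → f ⊛ constant 1# ≐ f
  ⊛-identityʳ f n = trans (⊛-comm f (constant 1#) n) (⊛-identityˡ f n)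

  ⊛-isCommutativeRing : IsCommutativeRing _≐_ _⊕_ _⊛_ (λ f n → - f n)
                        (constant 0#) (constant 1#)
  ⊛-isCommutativeRing = record
    { isRing = record
      { +-isAbelianGroup = record
        { isGroup = record
          { isMonoid = record
            { isSemigroup = record
              { isMagma = record
                { isEquivalence = record
                  { refl  = λ _ → refl
                  ; sym   = λ f≈g n → sym (f≈g n)
                  ; trans = λ f≈g g≈h n → trans (f≈g n) (g≈h n)
                  }
                ; ∙-cong = λ f≈ g≈ n → +-cong (f≈ n) (g≈ n)
                }
              ; assoc = λ f g h n → +-assoc _ _ _
              }
            ; identity = (λ f n → trans (+-congʳ (constant-0 n)) (+-identityˡ _))
                       , (λ f n → trans (+-congˡ (constant-0 n)) (+-identityʳ _))
            }
          ; inverse = (λ f n → trans (-‿inverseˡ _) (sym (constant-0 n)))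
                    , (λ f n → trans (-‿inverseʳ _) (sym (constant-0 n)))
          ; ⁻¹-cong = λ f≈g n → -‿cong (f≈g n)
          }
        ; comm = λ f g n → +-comm _ _
        }
      ; *-cong     = λ {f} {f′} {g} {g′} → ⊛-cong f f′ g g′
      ; *-assoc    = ⊛-assoc
      ; *-identity = ⊛-identityˡ , ⊛-identityʳ
      ; distrib    = (λ f g h n → trans (⊛-comm f (g ⊕ h) n)
                       (trans (⊛-distribʳ f g h n) (+-cong (⊛-comm g f n) (⊛-comm h f n))))
                   , ⊛-distribʳ
      }
    ; *-comm = ⊛-comm
    }

  ⊛-commutativeRing : CommutativeRing c ℓ
  ⊛-commutativeRing = record { isCommutativeRing = ⊛-isCommutativeRing }

  -- The partial sums of Σ xʲUʲ; the first n + 1 coefficients of the n-th one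
  -- are final, because the tail is divisible by xⁿ⁺¹.
  geometricPartial : Series → ℕ → Series
  geometricPartial U zero    = constant 1#
  geometricPartial U (suc n) =
    constant 1# ⊕ indeterminate ⊛ (U ⊛ geometricPartial U n)

  geometric : Series → Series
  geometric U n = geometricPartial U n n

  geometricPartial-head : ∀ U n → geometricPartial U n 0 ≈ 1#
  geometricPartial-head U zero    = refl
  geometricPartial-head U (suc n) =
    trans (+-congˡ (indeterminate-⊛-zero (U ⊛ geometricPartial U n))) (+-identityʳ 1#)

  -- Each step multiplies the previous partial sum by the indeterminate, so agreement up to degree
  -- `i` becomes agreement up to degree `suc i`.
  geometricPartial-stable : ∀ U m n i → i ≤ m → i ≤ n →
                            geometricPartial U m i ≈ geometricPartial U n i
  geometricPartial-stable U m n zero _ _ =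
    trans (geometricPartial-head U m) (sym (geometricPartial-head U n))
  geometricPartial-stable U (suc m) (suc n) (suc i) (s≤s i≤m) (s≤s i≤n) = +-congˡ (begin
    (indeterminate ⊛ (U ⊛ geometricPartial U m)) (suc i)
      ≈⟨ indeterminate-⊛ (U ⊛ geometricPartial U m) i ⟩
    (U ⊛ geometricPartial U m) i
      ≈⟨ ⊛-cong≤ U U (geometricPartial U m) (geometricPartial U n) i (λ _ _ → refl)
           (λ j j≤i → geometricPartial-stable U m n j (ℕ.≤-trans j≤i i≤m) (ℕ.≤-trans j≤i i≤n)) ⟩
    (U ⊛ geometricPartial U n) i
      ≈⟨ indeterminate-⊛ (U ⊛ geometricPartial U n) i ⟨
    (indeterminate ⊛ (U ⊛ geometricPartial U n)) (suc i) ∎)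

  geometric-unfold : ∀ U → geometric U ≐ constant 1# ⊕ indeterminate ⊛ (U ⊛ geometric U)
  geometric-unfold U zero    =
    sym (trans (+-congˡ (indeterminate-⊛-zero (U ⊛ geometric U))) (+-identityʳ 1#))
  geometric-unfold U (suc n) = +-congˡ (begin
    (indeterminate ⊛ (U ⊛ geometricPartial U n)) (suc n)
      ≈⟨ indeterminate-⊛ (U ⊛ geometricPartial U n) n ⟩
    (U ⊛ geometricPartial U n) n
      ≈⟨ ⊛-cong≤ U U (geometricPartial U n) (geometric U) n (λ _ _ → refl) 
           (λ j j≤n → geometricPartial-stable U n j j j≤n ℕ.≤-refl) ⟩
    (U ⊛ geometric U) n ≈⟨ indeterminate-⊛ (U ⊛ geometric U) n ⟨
    (indeterminate ⊛ (U ⊛ geometric U)) (suc n) ∎)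

-- Solving the equations for final runs in a commutative ring.

module RunEquations {c ℓ} (R : CommutativeRing c ℓ) where

  open CommutativeRing R hiding (zero)
  open RingProperties ring using (-‿distribˡ-*)
  open AbelianGroupProperties +-abelianGroup using (∙-cancelʳ)
  open ExpProperties commutativeSemiring
  open CommutativeSemigroupProperties *-commutativeSemigroup using (x∙yz≈y∙xz)
  open SumProperties semiring using (sum; sum-cong-≋)
  open SetoidReasoning setoid

  -- Expanding `A * F` by either hypothesis and cancelling `A * (S * F)` divides by `1# + - S`
  -- without forming that element.
  resolve : ∀ {F S A B} → F ≈ 1# + S * F → A ≈ B + S * A → A ≈ F * B
  resolve {F} {S} {A} {B} F≈ A≈ = ∙-cancelʳ (A * (S * F)) A (F * B) (begin
    A + A * (S * F)       ≈⟨ +-congʳ (*-identityʳ A) ⟨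
    A * 1# + A * (S * F)  ≈⟨ distribˡ A 1# (S * F) ⟨
    A * (1# + S * F)      ≈⟨ *-congˡ F≈ ⟨
    A * F                 ≈⟨ *-congʳ A≈ ⟩
    (B + S * A) * F       ≈⟨ distribʳ F B (S * A) ⟩
    B * F + S * A * F     ≈⟨ +-cong (*-comm B F) (trans (*-congʳ (*-comm S A)) (*-assoc A S F)) ⟩
    F * B + A * (S * F)   ∎)

  telescope : ∀ (E T : ℕ → Carrier) → (∀ j → T j ≈ E j + T (suc j)) →
              ∀ m → T 0 ≈ sum {m} (E ∘ toℕ) + T m
  telescope E T T≈ zero    = sym (+-identityˡ (T 0))
  telescope E T T≈ (suc m) = begin
    T 0                                          ≈⟨ T≈ 0 ⟩
    E 0 + T 1
      ≈⟨ +-congˡ (telescope (E ∘ suc) (T ∘ suc) (T≈ ∘ suc) m) ⟩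
    E 0 + (sum {m} (E ∘ suc ∘ toℕ) + T (suc m))  ≈⟨ +-assoc (E 0) _ (T (suc m)) ⟨
    sum {suc m} (E ∘ toℕ) + T (suc m)            ∎

  -- E j and T j enumerate the objects whose final run has length j,
  -- respectively at least j; an unmarked letter extends a run up to length m,
  -- and y marks each later extension.
  module _ {x y F S : Carrier} (m : ℕ) (E T : ℕ → Carrier)
           (F≈ : F ≈ 1# + S * F)
           (T₀≈F : T 0 ≈ F) (E₀≈1 : E 0 ≈ 1#)
           (T≈ : ∀ j → T j ≈ E j + T (suc j))
           (E≈ : ∀ j → j < m → E (suc j) ≈ x * E j + S * E (suc j))
           (Tₘ≈ : T (suc m) ≈ x * (E m + y * T (suc m)) + S * T (suc m)) where

    private
      extend : ∀ j → F * (x * (x ^ j * F ^ j)) ≈ x ^ suc j * F ^ suc j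
      extend j = begin
        F * (x * (x ^ j * F ^ j)) ≈⟨ *-congˡ (*-assoc x (x ^ j) (F ^ j)) ⟨
        F * (x ^ suc j * F ^ j)   ≈⟨ x∙yz≈y∙xz F (x ^ suc j) (F ^ j) ⟩
        x ^ suc j * F ^ suc j     ∎

      E≈power : ∀ j → j ≤ m → E j ≈ x ^ j * F ^ j
      E≈power zero    _   = trans E₀≈1 (sym (*-identityˡ 1#))
      E≈power (suc j) j<m = begin
        E (suc j)                 ≈⟨ resolve F≈ (E≈ j j<m) ⟩
        F * (x * E j)             ≈⟨ *-congˡ (*-congˡ (E≈power j (ℕ.<⇒≤ j<m))) ⟩
        F * (x * (x ^ j * F ^ j)) ≈⟨ extend j ⟩
        x ^ suc j * F ^ suc j     ∎

      P H : Carrier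
      P = x ^ suc m * F ^ suc m
      H = T (suc m)

      H≈ : H ≈ P + x * y * F * H
      H≈ = begin
        H                             ≈⟨ resolve F≈ Tₘ≈ ⟩
        F * (x * (E m + y * H))       ≈⟨ *-congˡ (distribˡ x (E m) (y * H)) ⟩
        F * (x * E m + x * (y * H))   ≈⟨ distribˡ F (x * E m) (x * (y * H)) ⟩
        F * (x * E m) + F * (x * (y * H))
          ≈⟨ +-cong (trans (*-congˡ (*-congˡ (E≈power m ℕ.≤-refl))) (extend m))
                    (trans (*-congˡ (sym (*-assoc x y H)))
                      (trans (sym (*-assoc F (x * y) H)) (*-congʳ (*-comm F (x * y))))) ⟩
        P + x * y * F * H             ∎

      H*[1-xyF]≈P : H * (1# + - (x * y * F)) ≈ P
      H*[1-xyF]≈P = begin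
        H * (1# + - U)      ≈⟨ *-comm H (1# + - U) ⟩
        (1# + - U) * H      ≈⟨ distribʳ H 1# (- U) ⟩
        1# * H + - U * H    ≈⟨ +-cong (*-identityˡ H) (sym (-‿distribˡ-* U H)) ⟩
        H + - (U * H)       ≈⟨ +-congʳ H≈ ⟩
        P + U * H + - (U * H) ≈⟨ +-assoc P (U * H) (- (U * H)) ⟩
        P + (U * H + - (U * H)) ≈⟨ +-congˡ (-‿inverseʳ (U * H)) ⟩
        P + 0#              ≈⟨ +-identityʳ P ⟩
        P                   ∎
        where U = x * y * F

    -- `telescope` separates the runs of length at most `m`, whose series are `x ^ j * F ^ j`, from
    -- the longer ones, whose series `H` is found by multiplying `H*[1-xyF]≈P` by the inverse.
    functionalEquation : ∀ {inv} → (1# + - (x * y * F)) * inv ≈ 1# →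
      F ≈ sum {suc m} (λ n → x ^ toℕ n * F ^ toℕ n) + x ^ suc m * F ^ suc m * inv
    functionalEquation {inv} inverseʳ = begin
      F                             ≈⟨ T₀≈F ⟨
      T 0                           ≈⟨ telescope E T T≈ (suc m) ⟩
      sum {suc m} (E ∘ toℕ) + H
        ≈⟨ +-cong (sum-cong-≋ {suc m} (λ i → E≈power (toℕ i) (ℕ.s≤s⁻¹ (Fin.toℕ<n i)))) H≈P*inv ⟩
      sum {suc m} (λ n → x ^ toℕ n * F ^ toℕ n) + P * inv ∎
      where
      H≈P*inv : H ≈ P * inv
      H≈P*inv = begin
        H                              ≈⟨ *-identityʳ H ⟨
        H * 1#                         ≈⟨ *-congˡ inverseʳ ⟨
        H * ((1# + - (x * y * F)) * inv) ≈⟨ *-assoc H _ inv ⟨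
        H * (1# + - (x * y * F)) * inv   ≈⟨ *-congʳ H*[1-xyF]≈P ⟩
        P * inv                        ∎

  fixedPoint⇒inverse : ∀ {x y F inv} → inv ≈ 1# + x * (y * F * inv) →
                       (1# + - (x * y * F)) * inv ≈ 1#
  fixedPoint⇒inverse {x} {y} {F} {inv} inv≈ = begin
    (1# + - U) * inv        ≈⟨ distribʳ inv 1# (- U) ⟩
    1# * inv + - U * inv    ≈⟨ +-cong (*-identityˡ inv) (sym (-‿distribˡ-* U inv)) ⟩
    inv + - (U * inv)       ≈⟨ +-congʳ inv≈ ⟩
    1# + x * (y * F * inv) + - (U * inv)
      ≈⟨ +-congʳ (+-congˡ (trans (sym (*-assoc x (y * F) inv)) (*-congʳ (sym (*-assoc x y F))))) ⟩
    1# + U * inv + - (U * inv)    ≈⟨ +-assoc 1# (U * inv) (- (U * inv)) ⟩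
    1# + (U * inv + - (U * inv))  ≈⟨ +-congˡ (-‿inverseʳ (U * inv)) ⟩
    1# + 0#                       ≈⟨ +-identityʳ 1# ⟩
    1#                            ∎
    where U = x * y * F

-- Binary trees of given size.

data Tree : Set where
  leaf : Tree
  node : Tree → Tree → Tree

size : Tree → ℕ
size leaf       = 0
size (node s t) = suc (size s ℕ.+ size t)

node-injective : ∀ {s s′ t t′} → node s t ≡ node s′ t′ → s ≡ s′ × t ≡ t′
node-injective ≡.refl = ≡.refl , ≡.refl

products : (ℕ → List Tree) → ∀ n → Fin (suc n) → List Tree
products ts n i = cartesianProductWith node (ts (toℕ i)) (ts (n ∸ toℕ i))

-- The fuel makes the recursion structural; it is irrelevant once it is at
-- least n.
treesWithin : ℕ → ℕ → List Tree
treesWithin _       zero    = leaf ∷ []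
treesWithin zero    (suc n) = []
treesWithin (suc f) (suc n) = concat (tabulate (products (treesWithin f) n))

trees : ℕ → List Tree
trees n = treesWithin n n

treesWithin-fuel : ∀ f n → n ≤ f → treesWithin f n ≡ trees n
treesWithin-fuel f n n≤f = go n≤f ℕ.≤-refl
  where
  -- Two arbitrary sufficient fuels are compared, since the recursive calls at sizes up to `n` may
  -- receive more fuel than their size.
  go : ∀ {f g n} → n ≤ f → n ≤ g → treesWithin f n ≡ treesWithin g n
  go z≤n       _         = ≡.refl
  go {n = suc n} (s≤s n≤f) (s≤s n≤g) = ≡.cong concat (List.tabulate-cong λ i →
    ≡.cong₂ (cartesianProductWith node)
      (let i≤n = ℕ.s≤s⁻¹ (Fin.toℕ<n i) in go (ℕ.≤-trans i≤n n≤f) (ℕ.≤-trans i≤n n≤g))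
      (let n∸i≤n = ℕ.m∸n≤m n (toℕ i) in go (ℕ.≤-trans n∸i≤n n≤f) (ℕ.≤-trans n∸i≤n n≤g)))

-- The Catalan recursion, with each fuel cut down to the size it serves.
trees-suc : ∀ n → trees (suc n) ≡ concat (tabulate (products trees n))
trees-suc n = ≡.cong concat (List.tabulate-cong λ i →
  ≡.cong₂ (cartesianProductWith node)
    (treesWithin-fuel n (toℕ i) (ℕ.s≤s⁻¹ (Fin.toℕ<n i)))
    (treesWithin-fuel n (n ∸ toℕ i) (ℕ.m∸n≤m n (toℕ i))))

∈-treesWithin⁻ : ∀ f n {t} → t ∈ treesWithin f n → size t ≡ n
∈-treesWithin⁻ f       zero    (here ≡.refl) = ≡.refl
∈-treesWithin⁻ (suc f) (suc n) t∈
  with ts , t∈ts , ts∈ ← ∈-concat⁻′ (tabulate (products (treesWithin f) n)) t∈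
  with i , ≡.refl ← ∈-tabulate⁻ {f = products (treesWithin f) n} ts∈
  with s , t , s∈ , t∈ , ≡.refl ←
    ∈-cartesianProductWith⁻ node (treesWithin f (toℕ i)) (treesWithin f (n ∸ toℕ i)) t∈ts
  rewrite ∈-treesWithin⁻ f (toℕ i) s∈ | ∈-treesWithin⁻ f (n ∸ toℕ i) t∈
  = ≡.cong suc (ℕ.m+[n∸m]≡n (ℕ.s≤s⁻¹ (Fin.toℕ<n i)))

∈-treesWithin⁺ : ∀ f t → size t ≤ f → t ∈ treesWithin f (size t)
∈-treesWithin⁺ f       leaf       _         = here ≡.refl
∈-treesWithin⁺ (suc f) (node s t) (s≤s s+t≤f) =
  ∈-concat⁺′ (∈-cartesianProductWith⁺ node s∈ t∈)
    (∈-tabulate⁺ {f = products (treesWithin f) (size s ℕ.+ size t)} i)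
  where
  i = Fin.fromℕ< (s≤s (ℕ.m≤m+n (size s) (size t)))

  i≡ : toℕ i ≡ size s
  i≡ = Fin.toℕ-fromℕ< _

  s∈ : s ∈ treesWithin f (toℕ i)
  s∈ = ≡.subst (λ n → s ∈ treesWithin f n) (≡.sym i≡)
    (∈-treesWithin⁺ f s (ℕ.≤-trans (ℕ.m≤m+n (size s) (size t)) s+t≤f))

  t∈ : t ∈ treesWithin f (size s ℕ.+ size t ∸ toℕ i)
  t∈ = ≡.subst (λ n → t ∈ treesWithin f n)
    (≡.sym (≡.trans (≡.cong (size s ℕ.+ size t ∸_) i≡) (ℕ.m+n∸m≡n (size s) (size t))))
    (∈-treesWithin⁺ f t (ℕ.≤-trans (ℕ.m≤n+m (size t) (size s)) s+t≤f))

∈-trees⁻ : ∀ {n t} → t ∈ trees n → size t ≡ n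
∈-trees⁻ {n} = ∈-treesWithin⁻ n n

∈-trees⁺ : ∀ t → t ∈ trees (size t)
∈-trees⁺ t = ∈-treesWithin⁺ (size t) t ℕ.≤-refl

treesWithin-unique : ∀ f n → Unique (treesWithin f n)
treesWithin-unique _       zero    = [] ∷ []
treesWithin-unique zero    (suc n) = []
treesWithin-unique (suc f) (suc n) = Unique.concat⁺
  (All.tabulate⁺ λ i → Unique.cartesianProductWith⁺ node node-injective
    (treesWithin-unique f (toℕ i)) (treesWithin-unique f (n ∸ toℕ i)))
  -- Blocks for different `i` are disjoint because `i` is the size of the left subtree.
  (AllPairs.tabulate⁺ λ i≢j (t∈i , t∈j) → i≢j (Fin.toℕ-injective
    (≡.trans (≡.sym (leftSize _ t∈i)) (leftSize _ t∈j))))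
  where
  sizeˡ : Tree → ℕ
  sizeˡ leaf       = 0
  sizeˡ (node s _) = size s

  leftSize : ∀ (i : Fin (suc n)) {t} →
    t ∈ products (treesWithin f) n i →
    sizeˡ t ≡ toℕ i
  leftSize i t∈
    with s , t , s∈ , _ , ≡.refl ←
      ∈-cartesianProductWith⁻ node (treesWithin f (toℕ i)) (treesWithin f (n ∸ toℕ i)) t∈
    = ∈-treesWithin⁻ f (toℕ i) s∈

trees-unique : ∀ n → Unique (trees n)
trees-unique n = treesWithin-unique n n

-- The length of the final increasing run of the word of the tree.
run : Tree → ℕ
run leaf                  = 0
run (node s leaf)         = suc (run s)
run (node s t@(node _ _)) = run t

-- The pattern is 12⋯k with k = m + 2.
occ : ℕ → Tree → ℕ
occ m leaf       = 0
occ m (node s t) = (if m <ᵇ run s then suc (occ m s) else occ m s) ℕ.+ occ m t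

-- Weighted generating functions of trees.

module TreeSeries {c ℓ} (R : CommutativeRing c ℓ) where

  open CommutativeRing R hiding (zero)
  open PowerSeries rawRing using (Series; constant; indeterminate)
    renaming (_⊛_ to infixl 7 _⊛_)
  open PowerSeriesProperties R
  open SumProperties semiring using (sum; sum-cong-≋)
  open ExpProperties commutativeSemiring
  open CommutativeSemigroupProperties
    (CommutativeMonoid.commutativeSemigroup +-commutativeMonoid)
    using (interchange)
  open SetoidReasoning setoid

  ∑ : {A : Set} → List A → (A → Carrier) → Carrier
  ∑ []       w = 0#
  ∑ (t ∷ ts) w = w t + ∑ ts w

  ∑-cong : ∀ {A : Set} (ts : List A) {v w} → (∀ t → v t ≈ w t) → ∑ ts v ≈ ∑ ts w
  ∑-cong []       v≈w = refl
  ∑-cong (t ∷ ts) v≈w = +-cong (v≈w t) (∑-cong ts v≈w)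

  ∑-zero : ∀ {A : Set} (ts : List A) {w} → (∀ {t} → t ∈ ts → w t ≈ 0#) → ∑ ts w ≈ 0#
  ∑-zero []       w≈0 = refl
  ∑-zero (t ∷ ts) w≈0 =
    trans (+-cong (w≈0 (here ≡.refl)) (∑-zero ts (w≈0 ∘ there))) (+-identityʳ 0#)

  ∑-+ : ∀ {A : Set} (ts : List A) v w → ∑ ts (λ t → v t + w t) ≈ ∑ ts v + ∑ ts w
  ∑-+ []       v w = sym (+-identityʳ 0#)
  ∑-+ (t ∷ ts) v w = trans (+-congˡ (∑-+ ts v w)) (interchange (v t) (w t) _ _)

  ∑-*ˡ : ∀ {A : Set} a (ts : List A) w → ∑ ts (λ t → a * w t) ≈ a * ∑ ts w
  ∑-*ˡ a []       w = sym (zeroʳ a)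
  ∑-*ˡ a (t ∷ ts) w = trans (+-congˡ (∑-*ˡ a ts w)) (sym (distribˡ a (w t) _))

  ∑-++ : ∀ {A : Set} (ss ts : List A) w → ∑ (ss ++ ts) w ≈ ∑ ss w + ∑ ts w
  ∑-++ []       ts w = sym (+-identityˡ _)
  ∑-++ (s ∷ ss) ts w = trans (+-congˡ (∑-++ ss ts w)) (sym (+-assoc (w s) _ _))

  ∑-map : ∀ {A B : Set} (g : A → B) (ts : List A) w → ∑ (List.map g ts) w ≡ ∑ ts (w ∘ g)
  ∑-map g []       w = ≡.refl
  ∑-map g (t ∷ ts) w = ≡.cong (w (g t) +_) (∑-map g ts w)

  ∑-concat-tabulate : ∀ {A : Set} {n} (g : Fin n → List A) w →
    ∑ (concat (tabulate g)) w ≈ sum (λ i → ∑ (g i) w)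
  ∑-concat-tabulate {n = zero}  g w = refl
  ∑-concat-tabulate {n = suc n} g w =
    trans (∑-++ (g zero) _ w) (+-congˡ (∑-concat-tabulate (g ∘ suc) w))

  ∑-cartesianProductWith : ∀ {A B C : Set} (g : A → B → C) {u v w} →
    (∀ a b → w (g a b) ≈ u a * v b) → ∀ as bs →
    ∑ (cartesianProductWith g as bs) w ≈ ∑ as u * ∑ bs v
  ∑-cartesianProductWith g {u} {v} {w} w≈ []       bs = sym (zeroˡ _)
  ∑-cartesianProductWith g {u} {v} {w} w≈ (a ∷ as) bs = begin
    ∑ (List.map (g a) bs ++ cartesianProductWith g as bs) w
      ≈⟨ ∑-++ (List.map (g a) bs) _ w ⟩
    ∑ (List.map (g a) bs) w + ∑ (cartesianProductWith g as bs) w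
      ≈⟨ +-cong (trans (reflexive (∑-map (g a) bs w))
                  (trans (∑-cong bs (w≈ a)) (∑-*ˡ (u a) bs v)))
                (∑-cartesianProductWith g w≈ as bs) ⟩
    u a * ∑ bs v + ∑ as u * ∑ bs v ≈⟨ distribʳ (∑ bs v) (u a) (∑ as u) ⟨
    (u a + ∑ as u) * ∑ bs v        ∎

  gf : (Tree → Carrier) → Series
  gf w n = ∑ (trees n) w

  infixl 7 _⊗_
  -- A root with independent weights on its two subtrees. The leaf gets `0#`, so that the series is
  -- exactly `indeterminate` times the product of the two series.
  _⊗_ : (Tree → Carrier) → (Tree → Carrier) → Tree → Carrier
  (u ⊗ v) leaf       = 0#
  (u ⊗ v) (node s t) = u s * v t

  -- The series of this weight is 1; as right factor of `_⊗_` it selects the trees with empty right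
  -- subtree.
  δ : Tree → Carrier
  δ leaf       = 1#
  δ (node _ _) = 0#

  gf-cong : ∀ {v w} → (∀ t → v t ≈ w t) → gf v ≐ gf w
  gf-cong v≈w n = ∑-cong (trees n) v≈w

  gf-+ : ∀ v w → gf (λ t → v t + w t) ≐ gf v ⊕ gf w
  gf-+ v w n = ∑-+ (trees n) v w

  gf-*ˡ : ∀ a w → gf (λ t → a * w t) ≐ constant a ⊛ gf w
  gf-*ˡ a w n = trans (∑-*ˡ a (trees n) w) (sym (constant-⊛ a (gf w) n))

  gf-δ : gf δ ≐ constant 1#
  gf-δ zero    = +-identityʳ 1#
  gf-δ (suc n) = ∑-zero (trees (suc n)) (λ {t} → δ≈0 {t})
    where
    δ≈0 : ∀ {t} → t ∈ trees (suc n) → δ t ≈ 0#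
    δ≈0 {leaf}     t∈ with () ← ∈-trees⁻ {suc n} t∈
    δ≈0 {node _ _} _  = refl

  gf-⊗ : ∀ u v → gf (u ⊗ v) ≐ indeterminate ⊛ (gf u ⊛ gf v)
  gf-⊗ u v zero    = trans (+-identityʳ 0#) (sym (indeterminate-⊛-zero (gf u ⊛ gf v)))
  gf-⊗ u v (suc n) = begin
    ∑ (trees (suc n)) (u ⊗ v)
      ≈⟨ reflexive (≡.cong (λ ts → ∑ ts (u ⊗ v)) (trees-suc n)) ⟩
    ∑ (concat (tabulate (products trees n))) (u ⊗ v)
      ≈⟨ ∑-concat-tabulate (products trees n) (u ⊗ v) ⟩
    sum (λ i → ∑ (products trees n i) (u ⊗ v))
      ≈⟨ sum-cong-≋ {suc n} (λ i → ∑-cartesianProductWith node {u} {v} {u ⊗ v} (λ _ _ → refl)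
           (trees (toℕ i)) (trees (n ∸ toℕ i))) ⟩
    (gf u ⊛ gf v) n ≈⟨ indeterminate-⊛ (gf u ⊛ gf v) n ⟨
    (indeterminate ⊛ (gf u ⊛ gf v)) (suc n) ∎

  when : Bool → Carrier → Carrier
  when b a = if b then a else 0#

  when-cong : ∀ b {a a′} → a ≈ a′ → when b a ≈ when b a′
  when-cong true  a≈ = a≈
  when-cong false _  = refl

  when-*ˡ : ∀ b a a′ → when b (a * a′) ≈ a * when b a′
  when-*ˡ true  a a′ = refl
  when-*ˡ false a a′ = sym (zeroʳ a)

  -- `j <ᵇ suc r` stands for `j ≤ r`, which means that `j` equals `r` or that `suc j ≤ r`.
  when-split : ∀ j r a → when (j <ᵇ suc r) a ≈ when (j ≡ᵇ r) a + when (suc j <ᵇ suc r) a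
  when-split zero    zero    a = sym (+-identityʳ a)
  when-split zero    (suc r) a = sym (+-identityˡ a)
  when-split (suc j) zero    a = sym (+-identityʳ 0#)
  when-split (suc j) (suc r) a = when-split j r a

  -- Where the guard holds, `r` is `j`, so the test `m <ᵇ r` fails.
  when-below : ∀ {m} j r a b → j < m →
               when (j ≡ᵇ r) (if m <ᵇ r then a else b) ≈ when (j ≡ᵇ r) b
  when-below {suc m} zero    zero    a b _         = refl
  when-below {suc m} zero    (suc r) a b _         = refl
  when-below {suc m} (suc j) zero    a b _         = refl
  when-below {suc m} (suc j) (suc r) a b (s≤s j<m) = when-below j r a b j<m

  -- Of the values `r ≥ m`, only `r = m` fails the test `m <ᵇ r`; all larger ones carry the factor
  -- `a`.
  when-beyond : ∀ m r a b → when (m <ᵇ suc r) (if m <ᵇ r then a * b else b) ≈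
                when (m ≡ᵇ r) b + a * when (suc m <ᵇ suc r) b
  when-beyond zero    zero    a b = sym (trans (+-congˡ (zeroʳ a)) (+-identityʳ b))
  when-beyond zero    (suc r) a b = sym (+-identityˡ (a * b))
  when-beyond (suc m) zero    a b = sym (trans (+-congˡ (zeroʳ a)) (+-identityʳ 0#))
  when-beyond (suc m) (suc r) a b = when-beyond m r a b

  module Weights (y : Carrier) (m : ℕ) where

    -- s is the weight of a left subtree, which includes the occurrence that ends
    -- at the letter of the root.
    q s : Tree → Carrier
    q t = y ^ occ m t
    s t = if m <ᵇ run t then y * q t else q t

    -- The weight `q` restricted to final runs of length exactly `j`, respectively at least `j`; the
    -- series are the `E` and `T` of `RunEquations`.
    e r : ℕ → Tree → Carrier
    e j t = when (j ≡ᵇ run t) (q t)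
    r j t = when (j <ᵇ suc (run t)) (q t)

    -- The occurrence at the root letter is charged to the left factor `s`, which makes the weight
    -- multiplicative.
    q-node : ∀ a b → q (node a b) ≈ s a * q b
    q-node a b =
      trans (^-homo-* y (if m <ᵇ run a then _ else _) (occ m b)) (*-congʳ (marked (m <ᵇ run a)))
      where
      marked : ∀ c → y ^ (if c then suc (occ m a) else occ m a) ≈ (if c then y * q a else q a)
      marked true  = refl
      marked false = refl

    q-decompose : ∀ t → q t ≈ δ t + (s ⊗ q) t
    q-decompose leaf       = sym (+-identityʳ 1#)
    q-decompose (node a b) = trans (q-node a b) (sym (+-identityˡ _))

    r-split : ∀ j t → r j t ≈ e j t + r (suc j) t
    r-split j t = when-split j (run t) (q t)

    e₀≈δ : ∀ t → e 0 t ≈ δ t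
    e₀≈δ leaf       = refl
    e₀≈δ (node a b) = go a b (q (node a b))
      where
      -- The weight stays fixed while the recursion follows the right spine to the last letter,
      -- which contributes at least 1 to the run.
      go : ∀ a b w → when (0 ≡ᵇ run (node a b)) w ≈ 0#
      go a leaf       w = refl
      go a (node b c) w = go b c w

    -- If the largest letter ends the word, it extends the final run of the
    -- letters before it; otherwise the final run lies to its right.
    runWeight : ∀ (p : ℕ → Bool) t → p 0 ≡ false → when (p (run t)) (q t) ≈
      ((λ a → when (p (suc (run a))) (s a)) ⊗ δ) t + (s ⊗ (λ b → when (p (run b)) (q b))) t
    runWeight p leaf              p0 rewrite p0 = sym (+-identityʳ 0#)
    runWeight p (node a leaf)     p0 rewrite p0 = begin
      when (p (suc (run a))) (q (node a leaf))
        ≈⟨ when-cong (p (suc (run a))) (trans (q-node a leaf) (*-identityʳ (s a))) ⟩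
      when (p (suc (run a))) (s a)               ≈⟨ *-identityʳ _ ⟨
      when (p (suc (run a))) (s a) * 1#          ≈⟨ +-identityʳ _ ⟨
      when (p (suc (run a))) (s a) * 1# + 0#     ≈⟨ +-congˡ (zeroʳ (s a)) ⟨
      when (p (suc (run a))) (s a) * 1# + s a * 0# ∎
    runWeight p (node a t@(node b c)) p0 = begin
      when (p (run t)) (q (node a t)) ≈⟨ when-cong (p (run t)) (q-node a t) ⟩
      when (p (run t)) (s a * q t)    ≈⟨ when-*ˡ (p (run t)) (s a) (q t) ⟩
      s a * when (p (run t)) (q t)    ≈⟨ +-identityˡ _ ⟨
      0# + s a * when (p (run t)) (q t) ≈⟨ +-congʳ (zeroʳ _) ⟨
      when (p (suc (run a))) (s a) * 0# + s a * when (p (run t)) (q t) ∎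

    -- A run of length `j < m` before the top letter is too short for that letter to end an
    -- occurrence, so `s` agrees with `q` there.
    e-decompose : ∀ j → j < m → ∀ t → e (suc j) t ≈ (e j ⊗ δ) t + (s ⊗ e (suc j)) t
    e-decompose j j<m t = trans (runWeight (suc j ≡ᵇ_) t ≡.refl) (+-congʳ (below t))
      where
      below : ∀ t → ((λ a → when (j ≡ᵇ run a) (s a)) ⊗ δ) t ≈ (e j ⊗ δ) t
      below leaf       = refl
      below (node a b) = *-congʳ (when-below j (run a) _ _ j<m)

    -- Appending the top letter gives a run longer than `m` in two ways: from a run of length `m`,
    -- unmarked, or from a longer one, with an occurrence marked by `y`.
    r-decompose : ∀ t → r (suc m) t ≈
      ((λ a → e m a + y * r (suc m) a) ⊗ δ) t + (s ⊗ r (suc m)) t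
    r-decompose t = trans (runWeight (λ k → suc m <ᵇ suc k) t ≡.refl) (+-congʳ (beyond t))
      where
      beyond : ∀ t → ((λ a → when (m <ᵇ suc (run a)) (s a)) ⊗ δ) t ≈
                     ((λ a → e m a + y * r (suc m) a) ⊗ δ) t
      beyond leaf       = refl
      beyond (node a b) = *-congʳ (when-beyond m (run a) y (q a))

    private
      x : Series
      x = indeterminate

      gf-⊗-δ : ∀ u → gf (u ⊗ δ) ≐ x ⊛ gf u
      gf-⊗-δ u n = trans (gf-⊗ u δ n) (⊛-cong x x (gf u ⊛ gf δ) (gf u) (λ _ → refl)
        (λ i → trans (⊛-cong (gf u) (gf u) (gf δ) (constant 1#) (λ _ → refl) gf-δ i)
                     (⊛-identityʳ (gf u) i)) n)

      gf-s⊗ : ∀ u → gf (s ⊗ u) ≐ x ⊛ gf s ⊛ gf u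
      gf-s⊗ u n = trans (gf-⊗ s u n) (sym (⊛-assoc x (gf s) (gf u) n))

    q-equation : gf q ≐ constant 1# ⊕ x ⊛ gf s ⊛ gf q
    q-equation n = trans (gf-cong q-decompose n) (trans (gf-+ δ (s ⊗ q) n)
      (+-cong (gf-δ n) (gf-s⊗ q n)))

    e₀-equation : gf (e 0) ≐ constant 1#
    e₀-equation n = trans (gf-cong e₀≈δ n) (gf-δ n)

    r-equation : ∀ j → gf (r j) ≐ gf (e j) ⊕ gf (r (suc j))
    r-equation j n = trans (gf-cong (r-split j) n) (gf-+ (e j) (r (suc j)) n)

    e-equation : ∀ j → j < m →
      gf (e (suc j)) ≐ x ⊛ gf (e j) ⊕ x ⊛ gf s ⊛ gf (e (suc j))
    e-equation j j<m n = trans (gf-cong (e-decompose j j<m) n)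
      (trans (gf-+ (e j ⊗ δ) (s ⊗ e (suc j)) n)
        (+-cong (gf-⊗-δ (e j) n) (gf-s⊗ (e (suc j)) n)))

    rₘ-equation : gf (r (suc m)) ≐
      x ⊛ (gf (e m) ⊕ constant y ⊛ gf (r (suc m))) ⊕ x ⊛ gf s ⊛ gf (r (suc m))
    rₘ-equation n = trans (gf-cong r-decompose n)
      (trans (gf-+ (u ⊗ δ) (s ⊗ r (suc m)) n)
        (+-cong (trans (gf-⊗-δ u n) (⊛-cong x x (gf u) _ (λ _ → refl)
                  (λ i → trans (gf-+ (e m) (λ t → y * r (suc m) t) i)
                    (+-congˡ (gf-*ˡ y (r (suc m)) i))) n))
                (gf-s⊗ (r (suc m)) n)))
      where
      u : Tree → Carrier
      u a = e m a + y * r (suc m) a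

open ≡ using (refl; sym; trans; cong; cong₂; subst; module ≡-Reasoning)

-- Runs and windows in lists, for an arbitrary relation.

module Runs {R : Rel ℕ 0ℓ} (R? : Decidable R) where

  initialRun : List ℕ → ℕ
  initialRun []          = 0
  initialRun (a ∷ [])    = 1
  initialRun (a ∷ b ∷ w) = if does (R? a b) then suc (initialRun (b ∷ w)) else 1

  -- A window has length m + 2; it is counted at its first letter.
  windows : ℕ → List ℕ → ℕ
  windows m []      = 0
  windows m (a ∷ w) =
    if suc m <ᵇ initialRun (a ∷ w) then suc (windows m w) else windows m w

  isRun : List ℕ → Bool
  isRun []          = true
  isRun (a ∷ [])    = true
  isRun (a ∷ b ∷ w) = if does (R? a b) then isRun (b ∷ w) else false

  finalRun : List ℕ → ℕ
  finalRun []      = 0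
  finalRun (a ∷ w) = if isRun (a ∷ w) then suc (length w) else finalRun w

  initialRun-∷ : ∀ {n ys} → All (R n) ys → initialRun (n ∷ ys) ≡ suc (initialRun ys)
  initialRun-∷ []                       = refl
  initialRun-∷ {n} {y ∷ ys} (Rny ∷ _) rewrite dec-true (R? n y) Rny = refl

  initialRun-stop : ∀ {n ys} → All (¬_ ∘ R n) ys → initialRun (n ∷ ys) ≡ 1
  initialRun-stop []                     = refl
  initialRun-stop {n} {y ∷ ys} (¬Rny ∷ _) rewrite dec-false (R? n y) ¬Rny = refl

  isRun⇒initialRun : ∀ x xs → isRun (x ∷ xs) ≡ true → initialRun (x ∷ xs) ≡ suc (length xs)
  isRun⇒initialRun x []        _ = refl
  isRun⇒initialRun x (x′ ∷ xs) p with does (R? x x′)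
  ... | true  = cong suc (isRun⇒initialRun x′ xs p)
  ... | false with () ← p

  isRun⇒finalRun : ∀ x xs → isRun (x ∷ xs) ≡ true → finalRun xs ≡ length xs
  isRun⇒finalRun x []        _ = refl
  isRun⇒finalRun x (x′ ∷ xs) p with does (R? x x′)
  ... | true  rewrite p = refl
  ... | false with () ← p

  -- The list `xs ++ n ∷ ys` models a word cut at its largest letter `n`. The lemmas named `stop`
  -- serve descents, where the run before `n` breaks off; those named `extend` serve ascents, where
  -- `n` prolongs that run and ends it.
  module Prefix {n : ℕ} (ys : List ℕ) where

    initialRun-++-stop : ∀ {x xs} → All (λ x → ¬ R x n) (x ∷ xs) →
                         initialRun (x ∷ xs ++ n ∷ ys) ≡ initialRun (x ∷ xs)
    initialRun-++-stop {x} {[]} (¬Rxn ∷ _) rewrite dec-false (R? x n) ¬Rxn = refl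
    initialRun-++-stop {x} {x′ ∷ xs} (_ ∷ ¬R) =
      cong (λ k → if does (R? x x′) then suc k else 1) (initialRun-++-stop ¬R)

    -- No window crosses from `xs` to `n`, as the step onto `n` violates `R`.
    windows-++-stop : ∀ {m xs} → All (λ x → ¬ R x n) xs →
                      windows m (xs ++ n ∷ ys) ≡ windows m xs ℕ.+ windows m (n ∷ ys)
    windows-++-stop []                                = refl
    windows-++-stop {m} {x ∷ xs} (¬Rxn ∷ ¬R)
      rewrite initialRun-++-stop (¬Rxn ∷ ¬R) | windows-++-stop {m} ¬R
      with suc m <ᵇ initialRun (x ∷ xs)
    ... | true  = refl
    ... | false = refl

    module _ (stop : All (¬_ ∘ R n) ys) where

      initialRun-++-extend : ∀ x xs → All (λ x → R x n) (x ∷ xs) →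
        initialRun (x ∷ xs ++ n ∷ ys) ≡
        (if isRun (x ∷ xs) then suc (suc (length xs)) else initialRun (x ∷ xs))
      initialRun-++-extend x [] (Rxn ∷ _)
        rewrite dec-true (R? x n) Rxn = cong suc (initialRun-stop stop)
      initialRun-++-extend x (x′ ∷ xs) (_ ∷ Rn) with does (R? x x′)
      ... | false = refl
      ... | true  =
        trans (cong suc (initialRun-++-extend x′ xs Rn)) (if-float suc (isRun (x′ ∷ xs)))

      -- A window that meets both `xs` and `n` must end at `n`, so there is at most one, and it
      -- exists when the final run of `xs` has at least `m + 1` letters. No window starts at `n`.
      windows-++-extend : ∀ m xs → All (λ x → R x n) xs → windows m (xs ++ n ∷ ys) ≡
        (if m <ᵇ finalRun xs then suc (windows m xs) else windows m xs) ℕ.+ windows m ys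
      windows-++-extend m []       []         rewrite initialRun-stop stop = refl
      windows-++-extend m (x ∷ xs) (Rxn ∷ Rn)
        rewrite initialRun-++-extend x xs (Rxn ∷ Rn) | windows-++-extend m xs Rn
        with isRun (x ∷ xs) in eq
      ... | true  rewrite isRun⇒initialRun x xs eq | isRun⇒finalRun x xs eq
        -- The first test belongs to `x` on the left side and to `n` on the right, the second
        -- conversely; both sides add the same two amounts, in all four cases.
        with m <ᵇ suc (length xs) | m <ᵇ length xs
      ... | true  | true  = refl
      ... | true  | false = refl
      ... | false | true  = refl
      ... | false | false = refl
      windows-++-extend m (x ∷ xs) (Rxn ∷ Rn) | false
        with suc m <ᵇ initialRun (x ∷ xs) | m <ᵇ finalRun xs
      ... | true  | true  = refl
      ... | true  | false = refl
      ... | false | true  = refl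
      ... | false | false = refl

  isRun-∷ʳ : ∀ {n} x xs → All (λ x → R x n) (x ∷ xs) → isRun (x ∷ xs ++ n ∷ []) ≡ isRun (x ∷ xs)
  isRun-∷ʳ {n} x [] (Rxn ∷ _) rewrite dec-true (R? x n) Rxn = refl
  isRun-∷ʳ x (x′ ∷ xs) (_ ∷ Rn) =
    cong (λ b → if does (R? x x′) then b else false) (isRun-∷ʳ x′ xs Rn)

  finalRun-∷ʳ : ∀ {n} xs → All (λ x → R x n) xs → finalRun (xs ++ n ∷ []) ≡ suc (finalRun xs)
  finalRun-∷ʳ []       []         = refl
  finalRun-∷ʳ {n} (x ∷ xs) (Rxn ∷ Rn)
    rewrite isRun-∷ʳ x xs (Rxn ∷ Rn) | finalRun-∷ʳ xs Rn | List.length-++-sucʳ xs n []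
          | List.++-identityʳ xs
    with isRun (x ∷ xs)
  ... | true  = refl
  ... | false = refl

  isRun-broken : ∀ {n y} x xs ys → ¬ R n y → isRun (x ∷ xs ++ n ∷ y ∷ ys) ≡ false
  isRun-broken {n} {y} x [] ys ¬Rny
    rewrite dec-false (R? n y) ¬Rny with does (R? x n)
  ... | true  = refl
  ... | false = refl
  isRun-broken x (x′ ∷ xs) ys ¬Rny rewrite isRun-broken x′ xs ys ¬Rny with does (R? x x′)
  ... | true  = refl
  ... | false = refl

  -- The pair `n`, `y` breaks every suffix that starts before `y`.
  finalRun-broken : ∀ {n y} xs ys → ¬ R n y →
                    finalRun (xs ++ n ∷ y ∷ ys) ≡ finalRun (y ∷ ys)
  finalRun-broken {n} {y} [] ys ¬Rny rewrite dec-false (R? n y) ¬Rny = refl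
  finalRun-broken (x ∷ xs) ys ¬Rny
    rewrite isRun-broken x xs ys ¬Rny = finalRun-broken xs ys ¬Rny

  module _ {A : Set} (g : A → ℕ) where

    window⇒initialRun : ∀ k a l → k ≤ length l → Linked (R on g) (a ∷ List.take k l) →
                        suc k ≤ initialRun (g a ∷ List.map g l)
    window⇒initialRun zero    a []      _        _        = s≤s z≤n
    window⇒initialRun zero    a (b ∷ l) _        _        with does (R? (g a) (g b))
    ... | true  = s≤s z≤n
    ... | false = s≤s z≤n
    window⇒initialRun (suc k) a (b ∷ l) (s≤s k≤) (Rab ∷ L)
      rewrite dec-true (R? (g a) (g b)) Rab = s≤s (window⇒initialRun k b l k≤ L)

    initialRun⇒window : ∀ k a l → suc k ≤ initialRun (g a ∷ List.map g l) →
                        k ≤ length l × Linked (R on g) (a ∷ List.take k l)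
    initialRun⇒window zero    a l       _        = z≤n , [-]
    initialRun⇒window (suc k) a []      (s≤s ())
    initialRun⇒window (suc k) a (b ∷ l) k≤       with R? (g a) (g b)
    ... | yes Rab = Product.map s≤s (Rab ∷_) (initialRun⇒window k b l (ℕ.s≤s⁻¹ k≤))
    ... | no  _   with s≤s () ← k≤

    -- Since `take` shortens silently, the bound on `length l` is what makes the `Linked` list a
    -- full window.
    window⇔initialRun : ∀ k l → (suc k ≤ length l × Linked (R on g) (List.take (suc k) l)) ⇔
                        suc k ≤ initialRun (List.map g l)
    window⇔initialRun k []      = mk⇔ (λ ()) (λ ())
    window⇔initialRun k (a ∷ l) = mk⇔
      (λ (k≤ , L) → window⇒initialRun k a l (ℕ.s≤s⁻¹ k≤) L)
      (Product.map₁ s≤s ∘ initialRun⇒window k a l)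

  -- The enumeration `h` of positions is arbitrary so that the induction can pass to `h ∘ suc` while
  -- keeping the predicate `P`.
  count-windows : ∀ {A : Set} {P : U.Pred A 0ℓ} (P? : U.Decidable P) m w {n} → length w ≡ n →
    (h : Fin n → A) → (∀ i → P (h i) ⇔ suc (suc m) ≤ initialRun (List.drop (toℕ i) w)) →
    length (List.filter P? (List.tabulate h)) ≡ windows m w
  count-windows P? m []      refl h P⇔ = refl
  count-windows P? m (a ∷ w) refl h P⇔
    with ih ← count-windows P? m w refl (h ∘ suc) (P⇔ ∘ suc)
    with P? (h zero) | suc m <ᵇ initialRun (a ∷ w) | ℕ.<ᵇ-reflects-< (suc m) (initialRun (a ∷ w))
  ... | yes p | true  | _      = cong suc ih
  ... | no ¬p | false | _      = ih
  ... | yes p | false | ofⁿ ¬q = contradiction (Equivalence.to (P⇔ zero) p) ¬q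
  ... | no ¬p | true  | ofʸ q  = contradiction (Equivalence.from (P⇔ zero) q) ¬p

-- Trees as 1-3-2-avoiding words.

mirror : Tree → Tree
mirror leaf       = leaf
mirror (node s t) = node (mirror t) (mirror s)

mirror-involutive : ∀ t → mirror (mirror t) ≡ t
mirror-involutive leaf       = refl
mirror-involutive (node s t) = cong₂ node (mirror-involutive s) (mirror-involutive t)

size-mirror : ∀ t → size (mirror t) ≡ size t
size-mirror leaf       = refl
size-mirror (node s t) = cong suc
  (trans (cong₂ ℕ._+_ (size-mirror t) (size-mirror s)) (ℕ.+-comm (size t) (size s)))

-- A 1-3-2-avoiding word with largest letter n is A n B, where every letter of A
-- exceeds every letter of B. The letters of word o t are o, …, o + size t - 1.
word : ℕ → Tree → List ℕ
word o leaf       = []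
word o (node s t) = word (size t ℕ.+ o) s ++ (size s ℕ.+ (size t ℕ.+ o)) ∷ word o t

length-word : ∀ o t → length (word o t) ≡ size t
length-word o leaf       = refl
length-word o (node s t) = begin
  length (word (size t ℕ.+ o) s ++ _ ∷ word o t)
    ≡⟨ List.length-++ (word (size t ℕ.+ o) s) ⟩
  length (word (size t ℕ.+ o) s) ℕ.+ suc (length (word o t))
    ≡⟨ cong₂ (λ a b → a ℕ.+ suc b) (length-word (size t ℕ.+ o) s) (length-word o t) ⟩
  size s ℕ.+ suc (size t)                                   ≡⟨ ℕ.+-suc (size s) (size t) ⟩
  suc (size s ℕ.+ size t)                                   ∎
  where open ≡-Reasoning

AvoidsList : List ℕ → Set
AvoidsList []      = ⊤
AvoidsList (a ∷ w) = AllPairs (λ b c → ¬ (a < c × c < b)) w × AvoidsList w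

Within : ℕ → ℕ → List ℕ → Set
Within lo hi = All (λ a → lo ≤ a × a < hi)

-- The 1-3-2-avoiding arrangements of o, …, o + length w - 1.
Valid : ℕ → List ℕ → Set
Valid o w = Unique w × Within o (length w ℕ.+ o) w × AvoidsList w

module _ {A : Set} {Q : Rel A 0ℓ} where

  allPairs-++⁻ : ∀ xs {ys} → AllPairs Q (xs ++ ys) →
                 AllPairs Q xs × AllPairs Q ys × All (λ x → All (Q x) ys) xs
  allPairs-++⁻ []       ps       = [] , ps , []
  allPairs-++⁻ (x ∷ xs) (p ∷ ps) =
    let pˡ , pʳ = All.++⁻ xs p ; psˡ , psʳ , cross = allPairs-++⁻ xs ps
    in pˡ ∷ psˡ , psʳ , pʳ ∷ cross

  all⇒allPairs : ∀ {xs} → All (λ c → ∀ b → Q b c) xs → AllPairs Q xs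
  all⇒allPairs []       = []
  all⇒allPairs (_ ∷ ps) = All.map (λ q → q _) ps ∷ all⇒allPairs ps

-- With the 1 of the pattern in `xs`, the 2 cannot be `n`, which nothing exceeds, nor lie in `ys`,
-- whose letters are smaller; and `n` itself cannot be a 1.
avoidsList-join : ∀ {n ys} xs → All (_< n) xs → All (_< n) ys → All (λ x → All (_< x) ys) xs →
                  AvoidsList xs → AvoidsList ys → AvoidsList (xs ++ n ∷ ys)
avoidsList-join [] _ ys<n _ _ avoids-ys =
  all⇒allPairs (All.map (λ c<n b (n<c , _) → ℕ.<-asym n<c c<n) ys<n) , avoids-ys
avoidsList-join {n} {ys} (x ∷ xs) (_ ∷ xs<n) ys<n (ys<x ∷ cross) (p , avoids-xs) avoids-ys =
  AllPairs.++⁺ p (All.map (λ c<x (x<c , _) → ℕ.<-asym x<c c<x) ys<x ∷ all⇒allPairs beyond)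
    (All.map (λ b<n → (λ (_ , n<b) → ℕ.<-asym n<b b<n) ∷ All.map (λ p → p _) beyond) xs<n)
  , avoidsList-join xs xs<n ys<n cross avoids-xs avoids-ys
  where
  beyond : All (λ c → ∀ b → ¬ (x < c × c < b)) ys
  beyond = All.map (λ c<x b (x<c , _) → ℕ.<-asym x<c c<x) ys<x

avoidsList-split : ∀ xs {n ys} → AvoidsList (xs ++ n ∷ ys) →
  AvoidsList xs × AvoidsList ys × All (λ x → All (λ c → ¬ (x < c × c < n)) ys) xs
avoidsList-split []       (_ , avoids) = tt , avoids , []
avoidsList-split (x ∷ xs) (p , avoids) =
  let avoids-xs , avoids-ys , cross = avoidsList-split xs avoids
      pˡ , pʳ , _ = allPairs-++⁻ xs p
  in (pˡ , avoids-xs) , avoids-ys , AllPairs.head pʳ ∷ cross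

module _ {A : Set} where

  -- Pigeonhole principle: the elements of `xs` are removed from `ys` one at a time.
  unique⇒length-≤ : ∀ {xs ys : List A} → Unique xs → (∀ {x} → x ∈ xs → x ∈ ys) →
                    length xs ≤ length ys
  unique⇒length-≤ {[]}     _        _ = z≤n
  unique⇒length-≤ {x ∷ xs} (x∉xs ∷ u) xs⊆ys
    with as , bs , refl ← ∈-∃++ (xs⊆ys (here refl))
    rewrite List.length-++-sucʳ as x bs = s≤s (unique⇒length-≤ u drop-x)
    where
    drop-x : ∀ {z} → z ∈ xs → z ∈ as ++ bs
    drop-x z∈ with ∈-++⁻ as (xs⊆ys (there z∈))
    ... | inj₁ z∈as         = ∈-++⁺ˡ z∈as
    ... | inj₂ (here refl)  = contradiction refl (All.lookup x∉xs z∈)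
    ... | inj₂ (there z∈bs) = ∈-++⁺ʳ as z∈bs

  ++-∷-injective : ∀ {xs xs′ ys ys′ : List A} {n} → n ∉ xs → n ∉ xs′ →
                   xs ++ n ∷ ys ≡ xs′ ++ n ∷ ys′ → xs ≡ xs′ × ys ≡ ys′
  ++-∷-injective {[]}     {[]}      _ _ refl = refl , refl
  ++-∷-injective {[]}     {_ ∷ xs′} _ n∉ refl = contradiction (here refl) n∉
  ++-∷-injective {_ ∷ xs} {[]}      n∉ _ refl = contradiction (here refl) n∉
  ++-∷-injective {x ∷ xs} {_ ∷ xs′} n∉ n∉′ eq with refl , eq′ ← List.∷-injective eq =
    Product.map₁ (cong (x ∷_)) (++-∷-injective (n∉ ∘ there) (n∉′ ∘ there) eq′)

within⇒length-≤ : ∀ {lo hi w} → Unique w → Within lo hi w → length w ≤ hi ∸ lo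
within⇒length-≤ {lo} {hi} {w} u within =
  subst (length w ≤_) (List.length-applyUpTo (lo ℕ.+_) (hi ∸ lo)) (unique⇒length-≤ u λ a∈ →
    let lo≤a , a<hi = All.lookup within a∈
    in subst (_∈ applyUpTo (lo ℕ.+_) (hi ∸ lo)) (ℕ.m+[n∸m]≡n lo≤a)
         (∈-applyUpTo⁺ (lo ℕ.+_) (ℕ.∸-monoˡ-< a<hi lo≤a)))

word-within : ∀ o t → Within o (size t ℕ.+ o) (word o t)
word-within o leaf       = []
word-within o (node s t) = All.++⁺
  (All.map (λ (lo , hi) → ℕ.≤-trans (ℕ.m≤n+m o (size t)) lo , ℕ.<-trans hi top<)
    (word-within (size t ℕ.+ o) s))
  ((ℕ.≤-trans (ℕ.m≤n+m o (size t)) (ℕ.m≤n+m (size t ℕ.+ o) (size s)) , top<)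
   ∷ All.map (λ (lo , hi) → lo ,
         ℕ.≤-<-trans (ℕ.≤-trans (ℕ.<⇒≤ hi) (ℕ.m≤n+m (size t ℕ.+ o) (size s))) top<)
       (word-within o t))
  where
  top< : size s ℕ.+ (size t ℕ.+ o) < suc (size s ℕ.+ size t ℕ.+ o)
  top< = s≤s (ℕ.≤-reflexive (sym (ℕ.+-assoc (size s) (size t) o)))

word-above : ∀ o s t → All (_< size s ℕ.+ (size t ℕ.+ o)) (word (size t ℕ.+ o) s)
word-above o s t = All.map proj₂ (word-within (size t ℕ.+ o) s)

word-below : ∀ o s t → All (_< size s ℕ.+ (size t ℕ.+ o)) (word o t)
word-below o s t =
  All.map (λ (_ , hi) → ℕ.<-≤-trans hi (ℕ.m≤n+m (size t ℕ.+ o) (size s))) (word-within o t)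

word-cross : ∀ o s t → All (λ x → All (_< x) (word o t)) (word (size t ℕ.+ o) s)
word-cross o s t = All.map
  (λ (lo , _) → All.map (λ (_ , hi) → ℕ.<-≤-trans hi lo) (word-within o t))
  (word-within (size t ℕ.+ o) s)

word-unique : ∀ o t → Unique (word o t)
word-unique o leaf       = []
word-unique o (node s t) = AllPairs.++⁺ (word-unique (size t ℕ.+ o) s)
  (All.map (λ y<n → ℕ.<⇒≢ y<n ∘ sym) (word-below o s t) ∷ word-unique o t)
  (All.zipWith (λ (x<n , ys<x) → ℕ.<⇒≢ x<n ∷ All.map (λ y<x → ℕ.<⇒≢ y<x ∘ sym) ys<x)
    (word-above o s t , word-cross o s t))

word-avoids : ∀ o t → AvoidsList (word o t)
word-avoids o leaf       = tt
word-avoids o (node s t) = avoidsList-join (word (size t ℕ.+ o) s)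
  (word-above o s t) (word-below o s t) (word-cross o s t) (word-avoids (size t ℕ.+ o) s) (word-avoids o t)

word-valid : ∀ o t → Valid o (word o t)
word-valid o t = word-unique o t
  , subst (λ n → Within o (n ℕ.+ o) (word o t)) (sym (length-word o t)) (word-within o t)
  , word-avoids o t

-- Taking the top letter as the 3 of the pattern puts every letter of `ys` below every letter of
-- `xs`. The ranges then follow by counting distinct letters: those of `ys` fit between `o` and any
-- letter of `xs`, those of `xs` between any letter of `ys` and the top.
valid-split : ∀ o xs ys → Valid o (xs ++ (length xs ℕ.+ (length ys ℕ.+ o)) ∷ ys) →
              Valid (length ys ℕ.+ o) xs × Valid o ys
valid-split o xs ys (unique , within , avoids) =
  (unique-xs , All.zip (All.tabulate above , All.tabulate xs<n) , avoids-xs) ,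
  (unique-ys , All.tabulate (λ y∈ → proj₁ (All.lookup within-ys y∈) , below y∈) , avoids-ys)
  where
  n = length xs ℕ.+ (length ys ℕ.+ o)

  n≡ : length (xs ++ n ∷ ys) ℕ.+ o ≡ suc n
  n≡ = begin
    length (xs ++ n ∷ ys) ℕ.+ o          ≡⟨ cong (ℕ._+ o) (List.length-++-sucʳ xs n ys) ⟩
    suc (length (xs ++ ys)) ℕ.+ o        ≡⟨ cong (λ k → suc k ℕ.+ o) (List.length-++ xs) ⟩
    suc (length xs ℕ.+ length ys ℕ.+ o)    ≡⟨ cong suc (ℕ.+-assoc (length xs) (length ys) o) ⟩
    suc n                              ∎
    where open ≡-Reasoning

  uniqueness = allPairs-++⁻ xs unique
  unique-xs  = proj₁ uniqueness
  n∉ys       = AllPairs.head (proj₁ (proj₂ uniqueness))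
  unique-ys  = AllPairs.tail (proj₁ (proj₂ uniqueness))
  distinct   = proj₂ (proj₂ uniqueness)

  avoidance  = avoidsList-split xs avoids
  avoids-xs  = proj₁ avoidance
  avoids-ys  = proj₁ (proj₂ avoidance)
  no-132     = proj₂ (proj₂ avoidance)

  within-xs : Within o (suc n) xs
  within-xs = subst (λ hi → Within o hi xs) n≡ (All.++⁻ˡ xs within)

  within-ys : Within o (suc n) ys
  within-ys = subst (λ hi → Within o hi ys) n≡ (All.tail (All.++⁻ʳ xs within))

  xs<n : ∀ {x} → x ∈ xs → x < n
  xs<n x∈ = ℕ.≤∧≢⇒< (ℕ.s≤s⁻¹ (proj₂ (All.lookup within-xs x∈)))
                    (All.head (All.lookup distinct x∈))

  ys<n : ∀ {y} → y ∈ ys → y < n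
  ys<n y∈ = ℕ.≤∧≢⇒< (ℕ.s≤s⁻¹ (proj₂ (All.lookup within-ys y∈)))
                    (All.lookup n∉ys y∈ ∘ sym)

  ys<xs : ∀ {x y} → x ∈ xs → y ∈ ys → y < x
  ys<xs x∈ y∈ = ℕ.≤∧≢⇒<
    (ℕ.≮⇒≥ λ x<y → All.lookup (All.lookup no-132 x∈) y∈ (x<y , ys<n y∈))
    (All.lookup (All.tail (All.lookup distinct x∈)) y∈ ∘ sym)

  above : ∀ {x} → x ∈ xs → length ys ℕ.+ o ≤ x
  above x∈ = ℕ.m≤o∸n⇒m+n≤o (length ys) (proj₁ (All.lookup within-xs x∈))
    (within⇒length-≤ unique-ys (All.tabulate λ y∈ → proj₁ (All.lookup within-ys y∈) , ys<xs x∈ y∈))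

  below : ∀ {y} → y ∈ ys → y < length ys ℕ.+ o
  below {y} y∈ = ℕ.+-cancelˡ-≤ (length xs) (suc y) (length ys ℕ.+ o)
    (ℕ.m≤o∸n⇒m+n≤o (length xs) (ys<n y∈)
      (within⇒length-≤ unique-xs (All.tabulate λ x∈ → ys<xs x∈ y∈ , xs<n x∈)))

-- If the top value were missing, `suc (length v)` distinct letters would fit into `length v`
-- values.
top∈ : ∀ o a v → Valid o (a ∷ v) → length v ℕ.+ o ∈ a ∷ v
top∈ o a v (unique , within , _) with (length v ℕ.+ o) ∈? (a ∷ v)
... | yes ∈w = ∈w
... | no  ∉w = contradiction
  (ℕ.≤-trans
    (within⇒length-≤ unique (All.zipWith
      (λ ((lo , hi) , top≢) → lo , ℕ.≤∧≢⇒< (ℕ.s≤s⁻¹ hi) (top≢ ∘ sym))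
      (within , All.¬Any⇒All¬ (a ∷ v) ∉w)))
    (ℕ.≤-reflexive (ℕ.m+n∸n≡m (length v) o)))
  (ℕ.<-irrefl refl)

word-node : ∀ o s t {xs ys} → word (length ys ℕ.+ o) s ≡ xs → word o t ≡ ys →
            word o (node s t) ≡ xs ++ (length xs ℕ.+ (length ys ℕ.+ o)) ∷ ys
word-node o s t refl refl rewrite length-word o t | length-word (size t ℕ.+ o) s = refl

word-surjective : ∀ o w → Valid o w → ∃ λ t → word o t ≡ w
word-surjective o w = go (length w) o w ℕ.≤-refl
  where
  -- The word is cut at its top letter; `fuel` bounds the lengths of the two parts, which are not
  -- structurally smaller arguments.
  go : ∀ fuel o w → length w ≤ fuel → Valid o w → ∃ λ t → word o t ≡ w
  go _          o []      _              _     = leaf , refl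
  go (suc fuel) o (a ∷ v) (s≤s v≤fuel) valid
    with xs , ys , eq ← ∈-∃++ (top∈ o a v valid)
    = node (proj₁ IHˡ) (proj₁ IHʳ)
    , trans (word-node o (proj₁ IHˡ) (proj₁ IHʳ) (proj₂ IHˡ) (proj₂ IHʳ)) (sym eq′)
    where
    length≡ : length v ≡ length xs ℕ.+ length ys
    length≡ = ℕ.suc-injective (begin
      length (a ∷ v)                       ≡⟨ cong length eq ⟩
      length (xs ++ (length v ℕ.+ o) ∷ ys)   ≡⟨ List.length-++-sucʳ xs _ ys ⟩
      suc (length (xs ++ ys))              ≡⟨ cong suc (List.length-++ xs) ⟩
      suc (length xs ℕ.+ length ys)          ∎)
      where open ≡-Reasoning

    eq′ : a ∷ v ≡ xs ++ (length xs ℕ.+ (length ys ℕ.+ o)) ∷ ys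
    eq′ = trans eq (cong (λ k → xs ++ k ∷ ys)
      (trans (cong (ℕ._+ o) length≡) (ℕ.+-assoc (length xs) (length ys) o)))

    valids = valid-split o xs ys (subst (Valid o) eq′ valid)

    IHˡ = go fuel (length ys ℕ.+ o) xs
      (ℕ.≤-trans (ℕ.m≤m+n (length xs) (length ys)) (ℕ.≤-trans (ℕ.≤-reflexive (sym length≡)) v≤fuel))
      (proj₁ valids)

    IHʳ = go fuel o ys
      (ℕ.≤-trans (ℕ.m≤n+m (length ys) (length xs)) (ℕ.≤-trans (ℕ.≤-reflexive (sym length≡)) v≤fuel))
      (proj₂ valids)

-- Equal words have equal lengths, hence equal top letters, and are cut there at the same place.
word-injective : ∀ o s t → word o s ≡ word o t → s ≡ t
word-injective o leaf       leaf         _  = refl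
word-injective o leaf       (node s t)   eq
  with () ← trans (cong length eq) (length-word o (node s t))
word-injective o (node s t) leaf         eq
  with () ← trans (cong length (sym eq)) (length-word o (node s t))
word-injective o (node s t) (node s′ t′) eq = cong₂ node s≡s′ t≡t′
  where
  n≡n′ : size s ℕ.+ (size t ℕ.+ o) ≡ size s′ ℕ.+ (size t′ ℕ.+ o)
  n≡n′ = begin
    size s ℕ.+ (size t ℕ.+ o)    ≡⟨ ℕ.+-assoc (size s) (size t) o ⟨
    size s ℕ.+ size t ℕ.+ o      ≡⟨ cong (ℕ._+ o) (ℕ.suc-injective
                                  (trans (sym (length-word o (node s t)))
                                    (trans (cong length eq) (length-word o (node s′ t′))))) ⟩
    size s′ ℕ.+ size t′ ℕ.+ o    ≡⟨ ℕ.+-assoc (size s′) (size t′) o ⟩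
    size s′ ℕ.+ (size t′ ℕ.+ o)  ∎
    where open ≡-Reasoning

  n∉ : ∀ s t → size s ℕ.+ (size t ℕ.+ o) ∉ word (size t ℕ.+ o) s
  n∉ s t n∈ = ℕ.<-irrefl refl (All.lookup (word-above o s t) n∈)

  parts : word (size t ℕ.+ o) s ≡ word (size t′ ℕ.+ o) s′ × word o t ≡ word o t′
  parts = ++-∷-injective (n∉ s t) (subst (_∉ word (size t′ ℕ.+ o) s′) (sym n≡n′) (n∉ s′ t′))
    (trans eq (cong (λ n → word (size t′ ℕ.+ o) s′ ++ n ∷ word o t′) (sym n≡n′)))

  t≡t′ : t ≡ t′
  t≡t′ = word-injective o t t′ (proj₂ parts)

  -- The offset of the left word is the size of the right subtree plus `o`, so the right subtrees
  -- are identified first.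
  s≡s′ : s ≡ s′
  s≡s′ = word-injective (size t ℕ.+ o) s s′
    (trans (proj₁ parts) (cong (λ u → word (size u ℕ.+ o) s′) (sym t≡t′)))

-- Runs and windows of the word of a tree.

run-node≢0 : ∀ s t → 0 ≢ run (node s t)
run-node≢0 s (node t u) eq = run-node≢0 t u eq

module Ascents  = Runs ℕ._<?_
module Descents = Runs ℕ._>?_

finalRun-word : ∀ o t → Ascents.finalRun (word o t) ≡ run t
finalRun-word o leaf = refl
finalRun-word o (node s leaf) =
  trans (Ascents.finalRun-∷ʳ (word o s) (word-above o s leaf)) (cong suc (finalRun-word o s))
finalRun-word o (node s t@(node u v))
  -- The right word is abstracted together with the facts about it, to expose its first letter `y`:
  -- the step from the top letter down to `y` breaks any longer run.
  with ih ← finalRun-word o t | word o t | word-below o s t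
... | []     | _       = contradiction ih (run-node≢0 u v)
... | y ∷ ys | y<n ∷ _ = trans (Ascents.finalRun-broken (word (size t ℕ.+ o) s) ys (ℕ.<⇒≯ y<n)) ih

windows-word : ∀ m o t → Ascents.windows m (word o t) ≡ occ m t
windows-word m o leaf       = refl
windows-word m o (node s t)
  rewrite Ascents.Prefix.windows-++-extend (word o t)
            (All.map ℕ.<⇒≯ (word-below o s t)) m (word (size t ℕ.+ o) s) (word-above o s t)
        | finalRun-word (size t ℕ.+ o) s | windows-word m (size t ℕ.+ o) s | windows-word m o t
  = refl

-- The top letter prolongs the initial decreasing run only if it comes first, that is, if the left
-- subtree is empty; this is the recursion of `run` on the mirror image.
initialRun-word : ∀ o t → Descents.initialRun (word o t) ≡ run (mirror t)
initialRun-word o leaf = refl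
initialRun-word o (node leaf t) =
  trans (Descents.initialRun-∷ (word-below o leaf t)) (cong suc (initialRun-word o t))
initialRun-word o (node s@(node u v) t)
  with ih ← initialRun-word (size t ℕ.+ o) s | word (size t ℕ.+ o) s | word-above o s t
... | x ∷ xs | xs<n = trans (Descents.Prefix.initialRun-++-stop (word o t) (All.map ℕ.<⇒≯ xs<n)) ih
... | []     | _    = contradiction ih (run-node≢0 (mirror v) (mirror u))

windows-word-mirror : ∀ m o t → Descents.windows m (word o t) ≡ occ m (mirror t)
windows-word-mirror m o leaf       = refl
windows-word-mirror m o (node s t)
  rewrite Descents.Prefix.windows-++-stop (word o t) {m} (All.map ℕ.<⇒≯ (word-above o s t))
        | Descents.initialRun-∷ (word-below o s t)
        | initialRun-word o t | windows-word-mirror m (size t ℕ.+ o) s | windows-word-mirror m o t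
  -- `mirror` swaps the subtrees and hence the two summands.
  = ℕ.+-comm (occ m (mirror s)) _

-- From vectors of letters to lists of numbers.

-- The alphabet size `N` is independent of the length, because a tail of a `Word` has fewer
-- positions over the same letters.
toWord : ∀ {N n} → Vec (Fin N) n → List ℕ
toWord v = List.map toℕ (toList v)

length-toWord : ∀ {N n} (v : Vec (Fin N) n) → length (toWord v) ≡ n
length-toWord v = trans (List.length-map toℕ (toList v)) (Vec.length-toList v)

toWord-injective : ∀ {N n} {u v : Vec (Fin N) n} → toWord u ≡ toWord v → u ≡ v
toWord-injective {u = []}    {[]}    _  = refl
toWord-injective {u = a ∷ u} {b ∷ v} eq =
  cong₂ _∷_ (Fin.toℕ-injective (List.∷-injectiveˡ eq)) (toWord-injective (List.∷-injectiveʳ eq))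

toWord-surjective : ∀ {N} w → All (_< N) w → ∃ λ (v : Vec (Fin N) (length w)) → toWord v ≡ w
toWord-surjective []      []          = [] , refl
toWord-surjective (a ∷ w) (a<N ∷ w<N) =
  let v , eq = toWord-surjective w w<N
  in Fin.fromℕ< a<N ∷ v , cong₂ _∷_ (Fin.toℕ-fromℕ< a<N) eq

toWord-within : ∀ {N n} (v : Vec (Fin N) n) → Within 0 N (toWord v)
toWord-within []      = []
toWord-within (a ∷ v) = (z≤n , Fin.toℕ<n a) ∷ toWord-within v

all-toWord⁺ : ∀ {N n} {P : ℕ → Set} (v : Vec (Fin N) n) →
              (∀ i → P (toℕ (lookup v i))) → All P (toWord v)
all-toWord⁺ []      _ = []
all-toWord⁺ (a ∷ v) p = p zero ∷ all-toWord⁺ v (p ∘ suc)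

all-toWord⁻ : ∀ {N n} {P : ℕ → Set} (v : Vec (Fin N) n) →
              All P (toWord v) → ∀ i → P (toℕ (lookup v i))
all-toWord⁻ (a ∷ v) (p ∷ ps) zero    = p
all-toWord⁻ (a ∷ v) (p ∷ ps) (suc i) = all-toWord⁻ v ps i

allPairs-toWord⁺ : ∀ {N n} {Q : Rel ℕ 0ℓ} (v : Vec (Fin N) n) →
  (∀ i j → i Fin.< j → Q (toℕ (lookup v i)) (toℕ (lookup v j))) → AllPairs Q (toWord v)
allPairs-toWord⁺ []      _ = []
allPairs-toWord⁺ (a ∷ v) q = all-toWord⁺ v (λ j → q zero (suc j) (s≤s z≤n)) ∷
  allPairs-toWord⁺ v (λ i j i<j → q (suc i) (suc j) (s≤s i<j))

allPairs-toWord⁻ : ∀ {N n} {Q : Rel ℕ 0ℓ} (v : Vec (Fin N) n) → AllPairs Q (toWord v) →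
  ∀ i j → i Fin.< j → Q (toℕ (lookup v i)) (toℕ (lookup v j))
allPairs-toWord⁻ (a ∷ v) (p ∷ ps) zero    (suc j) _         = all-toWord⁻ v p j
allPairs-toWord⁻ (a ∷ v) (p ∷ ps) (suc i) (suc j) (s≤s i<j) = allPairs-toWord⁻ v ps i j i<j

unique-toWord⁺ : ∀ {N n} {v : Vec (Fin N) n} → VecUnique.Unique v → Unique (toWord v)
unique-toWord⁺ VecAllPairs.[]       = []
unique-toWord⁺ {v = a ∷ v} (p VecAllPairs.∷ ps) =
  All.map⁺ (All.map (λ a≢ eq → a≢ (Fin.toℕ-injective eq)) (VecAll.toList⁺ p)) ∷ unique-toWord⁺ ps

unique-toWord⁻ : ∀ {N n} (v : Vec (Fin N) n) → Unique (toWord v) → VecUnique.Unique v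
unique-toWord⁻ []      []       = VecAllPairs.[]
unique-toWord⁻ (a ∷ v) (p ∷ ps) =
  VecAll.toList⁻ (All.map (λ a≢ eq → a≢ (cong toℕ eq)) (All.map⁻ p))
    VecAllPairs.∷ unique-toWord⁻ v ps

avoids-toWord⁺ : ∀ {N n} (v : Vec (Fin N) n) →
  (∀ a b c → a Fin.< b → b Fin.< c →
    ¬ (lookup v a Fin.< lookup v c × lookup v c Fin.< lookup v b)) →
  AvoidsList (toWord v)
avoids-toWord⁺ []      _ = tt
avoids-toWord⁺ (a ∷ v) avoids =
  allPairs-toWord⁺ v (λ b c b<c → avoids zero (suc b) (suc c) (s≤s z≤n) (s≤s b<c)) ,
  avoids-toWord⁺ v (λ a b c a<b b<c → avoids (suc a) (suc b) (suc c) (s≤s a<b) (s≤s b<c))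

avoids-toWord⁻ : ∀ {N n} (v : Vec (Fin N) n) → AvoidsList (toWord v) →
  ∀ a b c → a Fin.< b → b Fin.< c → ¬ (lookup v a Fin.< lookup v c × lookup v c Fin.< lookup v b)
avoids-toWord⁻ (x ∷ v) (p , _)      zero    (suc b) (suc c) _         (s≤s b<c) =
  allPairs-toWord⁻ v p b c b<c
avoids-toWord⁻ (x ∷ v) (_ , avoids) (suc a) (suc b) (suc c) (s≤s a<b) (s≤s b<c) =
  avoids-toWord⁻ v avoids a b c a<b b<c

valid-toWord⁺ : ∀ {n} (π : Word n) → VecUnique.Unique π → Avoids132 π → Valid 0 (toWord π)
valid-toWord⁺ π unique avoids = unique-toWord⁺ unique ,
  subst (λ hi → Within 0 hi (toWord π)) (sym (trans (ℕ.+-identityʳ _) (length-toWord π)))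
    (toWord-within π) ,
  avoids-toWord⁺ π avoids

∈-vectors : ∀ {N n} (v : Vec (Fin N) n) → v ∈ vectors N n
∈-vectors []      = here refl
∈-vectors (a ∷ v) = ∈-cartesianProductWith⁺ _∷_ (∈-allFin a) (∈-vectors v)

vectors-unique : ∀ N n → Unique (vectors N n)
vectors-unique N zero    = [] ∷ []
vectors-unique N (suc n) = Unique.cartesianProductWith⁺ _∷_ Vec.∷-injective
  (Unique.allFin⁺ N) (vectors-unique N n)

module _ {R : Rel ℕ 0ℓ} (R? : Decidable R) where

  open Runs R?

  -- `P` is given up to equality, so that `OccursAt` of either pattern fits by `refl`.
  windows-toWord : ∀ {N n} (v : Vec (Fin N) n) m {P : Fin n → Set} (P? : U.Decidable P) →
    (∀ i → P i ≡ (toℕ i ℕ.+ (2 ℕ.+ m) ≤ n ×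
                  Linked (R on toℕ) (List.take (2 ℕ.+ m) (List.drop (toℕ i) (toList v))))) →
    length (filter P? (allFin n)) ≡ windows m (toWord v)
  windows-toWord {n = n} v m {P} P? P≡ = count-windows P? m (toWord v) (length-toWord v) id P⇔
    where
    length-drop : ∀ i → length (List.drop i (toList v)) ≡ n ∸ i
    length-drop i = trans (List.length-drop i (toList v)) (cong (_∸ i) (Vec.length-toList v))

    P⇔ : ∀ i → P i ⇔ 2 ℕ.+ m ≤ initialRun (List.drop (toℕ i) (toWord v))
    P⇔ i rewrite P≡ i | List.drop-map {f = toℕ} (toℕ i) (toList v) = mk⇔
      (λ (k≤ , L) → Equivalence.to window
        (subst (2 ℕ.+ m ≤_) (sym (length-drop (toℕ i)))
          (ℕ.m+n≤o⇒m≤o∸n (2 ℕ.+ m) (subst (_≤ n) (ℕ.+-comm (toℕ i) (2 ℕ.+ m)) k≤)) , L))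
      (λ k≤ → Product.map₁ (λ k≤ → subst (_≤ n) (ℕ.+-comm (2 ℕ.+ m) (toℕ i))
        -- Subtraction is truncated, so this direction also uses that `toℕ i` is at most `n`.
        (ℕ.m≤o∸n⇒m+n≤o (2 ℕ.+ m) (ℕ.<⇒≤ (Fin.toℕ<n i))
          (subst (2 ℕ.+ m ≤_) (length-drop (toℕ i)) k≤)))
        (Equivalence.from window k≤))
      where
      window = window⇔initialRun toℕ (suc m) (List.drop (toℕ i) (toList v))

occurrences-12⋯ : ∀ {n} m (π : Word n) →
                  occurrences (12⋯ (2 ℕ.+ m)) π ≡ Ascents.windows m (toWord π)
occurrences-12⋯ m π = windows-toWord ℕ._<?_ π m (occursAt? (12⋯ (2 ℕ.+ m)) π) (λ _ → refl)

occurrences-⋯21 : ∀ {n} m (π : Word n) →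
                  occurrences ((2 ℕ.+ m) ⋯21) π ≡ Descents.windows m (toWord π)
occurrences-⋯21 m π =
  windows-toWord ℕ._>?_ π m (occursAt? ((2 ℕ.+ m) ⋯21) π) (λ _ → refl)

-- Counting permutations by trees.

-- `g` is to be the identity for ascending patterns and `mirror` for descending ones, so that
-- `word 0 ∘ g` carries `occ m` to the number of windows.
module _ (m : ℕ) (τ : Pattern) (windows : List ℕ → ℕ)
         (occurrences≡ : ∀ {n} (π : Word n) → occurrences τ π ≡ windows (toWord π))
         (g : Tree → Tree) (g-involutive : ∀ t → g (g t) ≡ t) (size-g : ∀ t → size (g t) ≡ size t)
         (windows-word-g : ∀ t → windows (word 0 (g t)) ≡ occ m t)
         where

  -- Permutations and trees are both mapped injectively to lists of numbers; the two duplicate-free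
  -- images include each other, so their lengths agree.
  f≡count : ∀ r n → Defs.f τ r n ≡ length (filter (λ t → occ m t ℕ.≟ r) (trees n))
  f≡count r n = trans (sym (List.length-map toWord good))
    (trans (ℕ.≤-antisym (unique⇒length-≤ unique-good good⊆) (unique⇒length-≤ unique-trees ⊆good))
      (List.length-map encode marked))
    where
    P? = λ (π : Word n) → avoids132? π ×-dec (occurrences τ π ℕ.≟ r)
    Q? = λ t → occ m t ℕ.≟ r

    good : List (Word n)
    good = filter P? (permutations n)

    marked : List Tree
    marked = filter Q? (trees n)

    encode : Tree → List ℕ
    encode t = word 0 (g t)

    encode-injective : ∀ {s t} → encode s ≡ encode t → s ≡ t
    encode-injective {s} {t} eq = trans (sym (g-involutive s))
      (trans (cong g (word-injective 0 (g s) (g t) eq)) (g-involutive t))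

    unique-good : Unique (List.map toWord good)
    unique-good = Unique.map⁺ toWord-injective
      (Unique.filter⁺ P? (Unique.filter⁺ unique? (vectors-unique n n)))

    unique-trees : Unique (List.map encode marked)
    unique-trees = Unique.map⁺ encode-injective (Unique.filter⁺ Q? (trees-unique n))

    good⊆ : ∀ {w} → w ∈ List.map toWord good → w ∈ List.map encode marked
    good⊆ w∈
      with π , π∈ , refl ← ∈-map⁻ toWord w∈
      with π∈perms , avoids , occ≡r ← ∈-filter⁻ P? {xs = permutations n} π∈
      with _ , unique ← ∈-filter⁻ unique? {xs = vectors n n} π∈perms
      with t , t≡ ← word-surjective 0 (toWord π) (valid-toWord⁺ π unique avoids)
      = subst (_∈ List.map encode marked) encode≡ (∈-map⁺ encode (∈-filter⁺ Q? gt∈ occ-gt))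
      where
      encode≡ : encode (g t) ≡ toWord π
      encode≡ = trans (cong (word 0) (g-involutive t)) t≡

      size≡ : size (g t) ≡ n
      size≡ = trans (size-g t)
        (trans (sym (length-word 0 t)) (trans (cong length t≡) (length-toWord π)))

      gt∈ : g t ∈ trees n
      gt∈ = subst (λ k → g t ∈ trees k) size≡ (∈-trees⁺ (g t))

      occ-gt : occ m (g t) ≡ r
      occ-gt = trans (sym (windows-word-g (g t)))
        (trans (cong windows encode≡) (trans (sym (occurrences≡ π)) occ≡r))

    ⊆good : ∀ {w} → w ∈ List.map encode marked → w ∈ List.map toWord good
    ⊆good w∈
      with t , t∈ , refl ← ∈-map⁻ encode w∈
      with t∈trees , occ≡r ← ∈-filter⁻ Q? {xs = trees n} t∈
      with unique , within , avoids ← word-valid 0 (g t)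
      = subst (_∈ List.map toWord good) π≡ (∈-map⁺ toWord (∈-filter⁺ P? π∈perms (avoids-π , occ-π)))
      where
      length≡ : length (encode t) ≡ n
      length≡ = trans (length-word 0 (g t)) (trans (size-g t) (∈-trees⁻ t∈trees))

      below : All (_< n) (encode t)
      below = All.map (λ (_ , <) → subst (_ <_) (trans (ℕ.+-identityʳ _) length≡) <) within

      -- `Word N` uses one number as length and as alphabet size; with separate variables `l` and
      -- `N` the equation between them can be matched with `refl`.
      preimage : ∀ {N l} → l ≡ N → (∃ λ (v : Vec (Fin N) l) → toWord v ≡ encode t) →
                 ∃ λ (v : Word N) → toWord v ≡ encode t
      preimage refl v = v

      π : Word n
      π = proj₁ (preimage length≡ (toWord-surjective (encode t) below))

      π≡ : toWord π ≡ encode t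
      π≡ = proj₂ (preimage length≡ (toWord-surjective (encode t) below))

      π∈perms : π ∈ permutations n
      π∈perms = ∈-filter⁺ unique? (∈-vectors π) (unique-toWord⁻ π (subst Unique (sym π≡) unique))

      avoids-π : Avoids132 π
      avoids-π = avoids-toWord⁻ π (subst AvoidsList (sym π≡) avoids)

      occ-π : occurrences τ π ≡ r
      occ-π = trans (occurrences≡ π) (trans (cong windows π≡) (trans (windows-word-g t) occ≡r))

f-12⋯ : ∀ m r n → Defs.f (12⋯ (2 ℕ.+ m)) r n ≡ length (filter (λ t → occ m t ℕ.≟ r) (trees n))
f-12⋯ m = f≡count m (12⋯ (2 ℕ.+ m)) (Ascents.windows m) (occurrences-12⋯ m)
  id (λ _ → refl) (λ _ → refl) (windows-word m 0)

f-⋯21 : ∀ m r n → Defs.f ((2 ℕ.+ m) ⋯21) r n ≡ length (filter (λ t → occ m t ℕ.≟ r) (trees n))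
f-⋯21 m = f≡count m ((2 ℕ.+ m) ⋯21) (Descents.windows m) (occurrences-⋯21 m)
  mirror mirror-involutive size-mirror
  (λ t → trans (windows-word-mirror m 0 (mirror t)) (cong (occ m) (mirror-involutive t)))

-- Parametrised by a raw ring, so that instantiating it with ℤ[y] yields the
-- operations of ℤ[y]⟦x⟧ syntactically: comparing unfolded series is very slow.
module TreeEquation {c ℓ} (R : RawRing c ℓ)
  (isCommutativeRing : IsCommutativeRing (RawRing._≈_ R) (RawRing._+_ R) (RawRing._*_ R)
                         (RawRing.-_ R) (RawRing.0# R) (RawRing.1# R))
  (y : RawRing.Carrier R) where

  private
    commutativeRing : CommutativeRing c ℓ
    commutativeRing = record { isCommutativeRing = isCommutativeRing }

  open PowerSeries R using (Series; constant; rawRing) renaming (indeterminate to x)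
  open RawRing rawRing using (_+_; _*_; -_; _≈_; 1#)
  open RawSemiringDefs (RawRing.rawSemiring rawRing) using (_^_; sum)
  open PowerSeriesProperties commutativeRing
  open TreeSeries commutativeRing using (gf)
  open RunEquations ⊛-commutativeRing
  private
    module S = CommutativeRing ⊛-commutativeRing

  -- The inverse is the geometric series of `x * (constant y * G)`; the factor `x` makes each
  -- coefficient a finite sum.
  inverse : ∀ G → AlgebraDefs.Invertible _≈_ 1# _*_ (1# + - (x * constant y * G))
  inverse G = inv
    , S.trans {inv * D} {D * inv} {1#} (S.*-comm inv D) inverseʳ
    , inverseʳ
    where
    D inv : Series
    D   = 1# + - (x * constant y * G)
    inv = geometric (constant y * G)

    inverseʳ : D * inv ≈ 1#
    inverseʳ = fixedPoint⇒inverse {x} {constant y} {G} {inv} (geometric-unfold (constant y * G))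

  -- `G` is a variable known only up to coefficientwise equality, so that the series of the
  -- permutations can be substituted without being unfolded.
  equation : ∀ k → 2 ≤ k → ∀ G → gf (TreeSeries.Weights.q commutativeRing y (k ∸ 2)) ≈ G →
    G ≈ sum {k ∸ 1} (λ n → x ^ toℕ n * G ^ toℕ n)
        + x ^ (k ∸ 1) * G ^ (k ∸ 1) * proj₁ (inverse G)
  equation (suc (suc m)) (s≤s (s≤s z≤n)) G gf-q≈G =
    -- The `S` of the run equations is `x * gf s`: a left part followed by its top letter.
    functionalEquation {x} {constant y} {G} {x * gf s} m (λ j → gf (e j)) (λ j → gf (r j))
      G-equation gf-q≈G e₀-equation r-equation e-equation rₘ-equation
      {proj₁ (inverse G)} (proj₂ (proj₂ (inverse G)))
    where
    open TreeSeries.Weights commutativeRing y m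

    G-equation : G ≈ 1# + x * gf s * G
    G-equation = S.trans {G} {gf q} {1# + x * gf s * G} (S.sym {gf q} {G} gf-q≈G)
      (S.trans {gf q} {1# + x * gf s * gf q} {1# + x * gf s * G} q-equation
        (S.+-cong {1#} {1#} {x * gf s * gf q} {x * gf s * G} (S.refl {1#})
          (S.*-cong {x * gf s} {x * gf s} {gf q} {G} (S.refl {x * gf s}) gf-q≈G)))

-- The coefficient ring of integer polynomials, and the conclusion.

open Defs
open AlgebraDefs _≈_ using (Invertible)
open RawSemiringDefs (RawRing.rawSemiring ℤ[y]) using () renaming (_^_ to _^ᴾ_)

module ℤSeries = PowerSeriesProperties ℤ.+-*-commutativeRing

ℤ⟦y⟧ : CommutativeRing 0ℓ 0ℓ
ℤ⟦y⟧ = ℤSeries.⊛-commutativeRing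

-- Equality of polynomials is equality of coefficients, so `coeff` pulls the ring laws back from
-- power series in `y`.
coeff-isRingMonomorphism :
  RingMorphisms.IsRingMonomorphism ℤ[y] (CommutativeRing.rawRing ℤ⟦y⟧) coeff
coeff-isRingMonomorphism = record
  { isRingHomomorphism = record
    { isSemiringHomomorphism = record
      { isNearSemiringHomomorphism = record
        { +-isMonoidHomomorphism = record
          { isMagmaHomomorphism = record
            { isRelHomomorphism = record { cong = λ p≈q → p≈q }
            ; homo = λ _ _ _ → refl
            }
          ; ε-homo = λ _ → refl
          }
        ; *-homo = λ _ _ _ → refl
        }
      ; 1#-homo = λ _ → refl
      }
    ; -‿homo = λ _ _ → refl
    }
  ; injective = λ p≈q → p≈q
  }

polynomials : CommutativeRing 0ℓ 0ℓ
polynomials = record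
  { isCommutativeRing = RingMonomorphism.isCommutativeRing coeff-isRingMonomorphism
      (CommutativeRing.isCommutativeRing ℤ⟦y⟧) }

module _ (m : ℕ) where

  open TreeSeries polynomials using (∑; gf)
  open TreeSeries.Weights polynomials (y 0) m

  -- `y 0`, the constant term of the series `y`, is the polynomial variable; multiplication by it
  -- shifts coefficients.
  coeff-power : ∀ a k → coeff (y 0 ^ᴾ a) k ≡ (if a ℕ.≡ᵇ k then 1ℤ else 0ℤ)
  coeff-power zero    zero    = refl
  coeff-power zero    (suc k) = refl
  coeff-power (suc a) zero    = ℤSeries.indeterminate-⊛-zero (coeff (y 0 ^ᴾ a))
  coeff-power (suc a) (suc k) =
    trans (ℤSeries.indeterminate-⊛ (coeff (y 0 ^ᴾ a)) k) (coeff-power a k)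

  coeff-∑-q : ∀ ts k → coeff (∑ ts q) k ≡ ℤ.+ length (filter (λ t → occ m t ℕ.≟ k) ts)
  coeff-∑-q []       zero    = refl
  coeff-∑-q []       (suc k) = refl
  coeff-∑-q (t ∷ ts) k =
    trans (cong₂ ℤ._+_ (coeff-power (occ m t) k) (coeff-∑-q ts k)) count-t
    where
    count : List Tree → ℕ
    count = length ∘ filter (λ t → occ m t ℕ.≟ k)

    count-t : (if occ m t ℕ.≡ᵇ k then 1ℤ else 0ℤ) ℤ.+ ℤ.+ count ts ≡ ℤ.+ count (t ∷ ts)
    -- `_≟_` decides by `_≡ᵇ_`, so one case split reduces both the coefficient and the filter.
    count-t with occ m t ℕ.≡ᵇ k
    ... | true  = refl
    ... | false = refl

open TreeEquation ℤ[y] (CommutativeRing.isCommutativeRing polynomials) (y 0)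

gf-q≈F : ∀ k → 2 ≤ k →
         TreeSeries.gf polynomials (TreeSeries.Weights.q polynomials (y 0) (k ∸ 2)) ≈ F (12⋯ k)
gf-q≈F (suc (suc m)) (s≤s (s≤s z≤n)) n r =
  trans (coeff-∑-q m (trees n) r) (cong ℤ.+_ (sym (f-12⋯ m r n)))

F-⋯21≈F-12⋯ : ∀ k → 2 ≤ k → F (k ⋯21) ≈ F (12⋯ k)
F-⋯21≈F-12⋯ (suc (suc m)) (s≤s (s≤s z≤n)) n r =
  cong ℤ.+_ (trans (f-⋯21 m r n) (sym (f-12⋯ m r n)))

theorem2p20 : ∀ (k : ℕ) → 2 ≤ k →
    F (k ⋯21) ≈ F (12⋯ k) ×
    (let G = F (12⋯ k) in
    Σ[ inv ∈ Invertible 1# _*_ (1# + - (x * y * G)) ]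
    G ≈ sum {k ∸ 1} (λ n → x ^ toℕ n * G ^ toℕ n)
    + x ^ (k ∸ 1) * G ^ (k ∸ 1) * proj₁ inv)
theorem2p20 k 2≤k =
  F-⋯21≈F-12⋯ k 2≤k , inverse (F (12⋯ k)) , equation k 2≤k (F (12⋯ k)) (gf-q≈F k 2≤k)
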